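{- Let $\alpha$ be an irrational number with simple continued fraction expansion $\alpha=[b_0;b_1,b_2,\ldots]$, and let $F_n$ be the $n$-th Fibonacci number. Then $$\limsup_{n\to\infty}\frac{\ln b_{n+1}}{\ln(F_n b_1b_2\cdots b_n)}\le\mu(\alpha)-2\le\limsup_{n\to\infty}\frac{\ln b_{n+1}}{\ln(F_n+b_1b_2\cdots b_n)},$$ $$\limsup_{n\to\infty}\frac{\ln b_{n+1}}{F_n b_1b_2\cdots b_n}\le\ln\beta(\alpha)\le\limsup_{n\to\infty}\frac{\ln b_{n+1}}{F_n+b_1b_2\cdots b_n}.$$
   Context: Irrationality exponent: for a real irrational number $\alpha$, $\mu(\alpha)$ is the least real $\mu>0$ such that for every $\varepsilon>0$ there is a positive integer $q(\varepsilon)$ with $\left|\alpha-\frac pq\right|>q^{ -(\mu+\varepsilon)}$ for all integers $p,q$ with $q\ge q(\varepsilon)$; if no such $\mu$ exists, $\mu(\alpha)=\infty$. Irrationality base: $\beta(\alpha)$ is the least real $\beta\ge 1$ such that for every $\varepsilon>0$ there is a positive integer $q(\varepsilon)$ with $\left|\alpha-\frac pq\right|>\frac{1}{(\beta+\varepsilon)^q}$ for all integers $p,q$ with $q\ge q(\varepsilon)$; if no such $\beta$ exists, $\beta(\alpha)=\infty$. Conventions: $b_0$ is an integer, $b_1,b_2,\ldots$ are positive integers, and $[b_0;b_1,b_2,\ldots]=b_0+\cfrac{1}{b_1+\cfrac{1}{b_2+\cdots}}$. The Fibonacci numbers are indexed by $F_1=1$, $F_2=2$, $F_{n+1}=F_n+F_{n-1}$.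 The inequalities hold in the extended reals, with $\ln\infty=\infty$. -}

module Defs where

open import Algebra.Bundles using (CommutativeRing; Semiring)
open import Algebra.Core using (Op₁; Op₂)
import Algebra.Definitions.RawSemiring as RawSemiringDefs
open import Algebra.Structures using (IsCommutativeRing)
open import Axiom.ExcludedMiddle using (ExcludedMiddle)
open import Data.Bool.Base using (if_then_else_)
open import Data.Integer.Base as ℤ using (ℤ; +_; -[1+_]; 1ℤ)
open import Data.Nat.Base as ℕ using (ℕ; zero; suc)
open import Data.Product.Base using (∃; ∃-syntax; _×_; _,_; proj₁)
open import Function.Base using (flip)
open import Level using (0ℓ)
import Relation.Binary.Construct.Add.Extrema.NonStrict as AddExtrema
import Relation.Binary.Construct.Add.Supremum.NonStrict as AddSupremum
import Relation.Binary.Construct.StrictToNonStrict as StrictToNonStrict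
open import Relation.Binary.Core using (Rel)
open import Relation.Binary.PropositionalEquality.Core using (_≡_)
open import Relation.Binary.Structures using (IsStrictTotalOrder)
open import Relation.Nullary.Construct.Add.Extrema using (_±; [_]; ⊥±; ⊤±)
import Relation.Nullary.Construct.Add.Supremum as Sup
open import Relation.Nullary.Decidable.Core using (yes; no; does)
open import Relation.Nullary.Negation.Core using (¬_; contradiction)
open import Relation.Unary using (Pred)

module _ {A : Set} (_≤_ : Rel A 0ℓ) where

  IsUpperBound : Pred A 0ℓ → Pred A 0ℓ
  IsUpperBound S u = ∀ x → S x → x ≤ u

  IsLeast : Pred A 0ℓ → Pred A 0ℓ
  IsLeast S m = S m × (∀ x → S x → m ≤ x)

  IsSupremum : Pred A 0ℓ → Pred A 0ℓ
  IsSupremum S = IsLeast (IsUpperBound S)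

-- The real numbers: a Dedekind-complete ordered field (unique up to
-- isomorphism) together with its exponential and natural logarithm.
record RealNumbers : Set₁ where
  infix  9 _⁻¹
  infix  8 -_
  infixl 7 _*_ _/_
  infixl 6 _+_
  infix  4 _≈_ _<_

  field
    Carrier             : Set
    _≈_ _<_             : Rel Carrier 0ℓ
    _+_ _*_             : Op₂ Carrier
    -_ _⁻¹              : Op₁ Carrier
    0# 1#               : Carrier
    isCommutativeRing   : IsCommutativeRing _≈_ _+_ _*_ -_ 0# 1#
    isStrictTotalOrder  : IsStrictTotalOrder _≈_ _<_
    0<1                 : 0# < 1#
    +-monoʳ-<           : ∀ x {y z} → y < z → x + y < x + z
    *-pos               : ∀ {x y} → 0# < x → 0# < y → 0# < x * y
    -- The value of 0# ⁻¹ is left unspecified.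
    *-inverseʳ          : ∀ {x} → ¬ x ≈ 0# → x * x ⁻¹ ≈ 1#

  open StrictToNonStrict _≈_ _<_ public using (_≤_)

  field
    complete : (S : Pred Carrier 0ℓ) → ∃ S → ∃ (IsUpperBound _≤_ S) →
               ∃ (IsSupremum _≤_ S)

  -- On a complete ordered field exactly one homomorphism from addition to
  -- multiplication satisfies 1 + x ≤ exp x. Only the values of ln at
  -- positive reals are specified.
  field
    exp ln   : Op₁ Carrier
    exp-cong : ∀ {x y} → x ≈ y → exp x ≈ exp y
    exp-+    : ∀ x y → exp (x + y) ≈ exp x * exp y
    1+x≤exp  : ∀ x → (1# + x) ≤ exp x
    exp-ln   : ∀ {x} → 0# < x → exp (ln x) ≈ x

  commutativeRing : CommutativeRing 0ℓ 0ℓ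
  commutativeRing = record { isCommutativeRing = isCommutativeRing }

  open CommutativeRing commutativeRing public using (_-_)
  open RawSemiringDefs
    (Semiring.rawSemiring (CommutativeRing.semiring commutativeRing)) public
    using (_^_) renaming (_×_ to _·_)
  open IsStrictTotalOrder isStrictTotalOrder public using (_<?_)

  _/_ : Op₂ Carrier
  x / y = x * y ⁻¹

  ∣_∣ : Op₁ Carrier
  ∣ x ∣ = if does (x <? 0#) then - x else x

  fromℕ : ℕ → Carrier
  fromℕ n = n · 1#

  fromℤ : ℤ → Carrier
  fromℤ (+ n)      = fromℕ n
  fromℤ (-[1+ n ]) = - fromℕ (suc n)

  -- Meaningful for positive x only.
  infixr 8 _^ʳ_
  _^ʳ_ : Op₂ Carrier
  x ^ʳ y = exp (y * ln x)

-- The indexing with F 1 = 1 and F 2 = 2.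
F : ℕ → ℕ
F 0             = 1
F 1             = 1
F (suc (suc n)) = F (suc n) ℕ.+ F n

-- ∏ b n = b 1 * ⋯ * b n
∏ : (ℕ → ℤ) → ℕ → ℤ
∏ b zero    = 1ℤ
∏ b (suc n) = ∏ b n ℤ.* b (suc n)

module Analysis (em : ExcludedMiddle 0ℓ) (ℝ : RealNumbers) where
  open RealNumbers ℝ

  Irrational : Carrier → Set
  Irrational α = ∀ (p : ℤ) (q : ℕ) → 1 ℕ.≤ q → ¬ α ≈ fromℤ p / fromℕ q

  infix 4 _⟶_ _HasContinuedFraction_
  _⟶_ : (ℕ → Carrier) → Carrier → Set
  u ⟶ x = ∀ ε → 0# < ε → ∃[ N ] (∀ n → N ℕ.≤ n → ∣ u n - x ∣ < ε)

  -- convergent b n = [b 0; b 1, …, b n]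
  convergent : (ℕ → ℤ) → ℕ → Carrier
  convergent b zero    = fromℤ (b 0)
  convergent b (suc n) = fromℤ (b 0) + convergent (λ k → b (suc k)) n ⁻¹

  -- α = [b 0; b 1, b 2, …]
  _HasContinuedFraction_ : Carrier → (ℕ → ℤ) → Set
  α HasContinuedFraction b = (∀ n → 1 ℕ.≤ n → ℤ.0ℤ ℤ.< b n) × convergent b ⟶ α

  open AddExtrema _≤_ public using (_≤±_)
  private module ≤± = AddExtrema _≤_

  ≰⊥ : ∀ {x} → ¬ [ x ] ≤± ⊥±
  ≰⊥ AddSupremum.[ () ]

  -- Every set of extended reals has a supremum; the supremum of the empty
  -- set is -∞.
  supremum : (S : Pred (Carrier ±) 0ℓ) → ∃ (IsSupremum _≤±_ S)
  supremum S with em {∃ (IsUpperBound _≤_ (λ x → S [ x ]))} | em {S ⊤±}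
  ... | _            | yes ⊤∈S = ⊤± , (λ x _ → x ≤±.≤⊤±) , λ t ub → ub ⊤± ⊤∈S
  ... | no unbounded | no _    = ⊤± , (λ x _ → x ≤±.≤⊤±) , least
    where
    least : ∀ t → IsUpperBound _≤±_ S t → ⊤± ≤± t
    least ⊤±    _  = ⊤± ≤±.≤⊤±
    least [ t ] ub =
      contradiction (t , λ x Sx → ≤±.[≤]-injective (ub [ x ] Sx)) unbounded
    least ⊥±    ub =
      contradiction (0# , λ x Sx → contradiction (ub [ x ] Sx) ≰⊥) unbounded
  ... | yes bounded  | no ⊤∉S  with em {∃ (λ x → S [ x ])}
  ...   | no empty    = ⊥± , upper , λ t _ → ≤±.⊥±≤ t
    where
    upper : IsUpperBound _≤±_ S ⊥±
    upper ⊤±    Sx = contradiction Sx ⊤∉S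
    upper [ x ] Sx = contradiction (x , Sx) empty
    upper ⊥±    _  = ≤±.⊥±≤ ⊥±
  ...   | yes inhabited@(x₀ , Sx₀) with complete (λ x → S [ x ]) inhabited bounded
  ...     | s , s-upper , s-least = [ s ] , upper , least
    where
    upper : IsUpperBound _≤±_ S [ s ]
    upper ⊤±    Sx = contradiction Sx ⊤∉S
    upper [ x ] Sx = ≤±.[ s-upper x Sx ]
    upper ⊥±    _  = ≤±.⊥±≤ [ s ]
    least : ∀ t → IsUpperBound _≤±_ S t → [ s ] ≤± t
    least ⊤±    _  = [ s ] ≤±.≤⊤±
    least [ t ] ub = ≤±.[ s-least t (λ x Sx → ≤±.[≤]-injective (ub [ x ] Sx)) ]
    least ⊥±    ub = contradiction (ub [ x₀ ] Sx₀) ≰⊥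

  sup : Pred (Carrier ±) 0ℓ → Carrier ±
  sup S = proj₁ (supremum S)

  infimum : (S : Pred (Carrier ±) 0ℓ) → ∃ (IsSupremum (flip _≤±_) S)
  infimum S with supremum (IsUpperBound (flip _≤±_) S)
  ... | i , i-upper , i-least =
    i , (λ x Sx → i-least x (λ t lb → lb x Sx)) , i-upper

  inf : Pred (Carrier ±) 0ℓ → Carrier ±
  inf S = proj₁ (infimum S)

  -- limsup u = inf { sup { u k ∣ k ≥ n } ∣ n ∈ ℕ }
  limsup : (ℕ → Carrier) → Carrier ±
  limsup u = inf λ s → ∃[ n ] s ≡ sup λ x → ∃[ k ] (n ℕ.≤ k × x ≡ [ u k ])

  -- Elements of Carrier Sup.⁺ are reals or ∞.
  least : Pred Carrier 0ℓ → Carrier Sup.⁺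
  least P with em {∃ (IsLeast _≤_ P)}
  ... | yes (m , _) = Sup.[ m ]
  ... | no _        = Sup.⊤⁺

  extend : Op₁ Carrier → Carrier Sup.⁺ → Carrier ±
  extend f Sup.[ x ] = [ f x ]
  extend f Sup.⊤⁺    = ⊤±

  irrationalityExponent : Carrier → Carrier Sup.⁺
  irrationalityExponent α = least λ μ → 0# < μ ×
    (∀ ε → 0# < ε → ∃[ Q ] (1 ℕ.≤ Q × (∀ (p : ℤ) (q : ℕ) → Q ℕ.≤ q →
      fromℕ q ^ʳ (- (μ + ε)) < ∣ α - fromℤ p / fromℕ q ∣)))

  irrationalityBase : Carrier → Carrier Sup.⁺
  irrationalityBase α = least λ β → 1# ≤ β ×
    (∀ ε → 0# < ε → ∃[ Q ] (1 ℕ.≤ Q × (∀ (p : ℤ) (q : ℕ) → Q ℕ.≤ q →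
      1# / (β + ε) ^ q < ∣ α - fromℤ p / fromℕ q ∣)))

  infixl 6 _-⁺_
  _-⁺_ : Carrier Sup.⁺ → Carrier → Carrier ±
  x -⁺ y = extend (_- y) x

  ln⁺ : Carrier Sup.⁺ → Carrier ±
  ln⁺ = extend ln

{-# OPTIONS --safe #-}

-- Let p n / q n be the convergents of α. From q n (q (n + 1) + q n) |α - p n / q n| ≥ 1 and
-- q n q (n + 1) |α - p n / q n| ≤ 1, the distance from α to p n / q n is 1 / (q n ² b (n + 1)) up
-- to a constant factor. Thus "|α - r / s| > exp (- h s) for all large s" forces
-- ln b (n + 1) + 2 ln (q n) < h (q n); conversely it holds as soon as h s exceeds 2 ln (2 s) plus
-- every ln b (n + 1) with q n ≤ s, because a fraction r / s that is not a convergent satisfies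
-- |α - r / s| ≥ 1 / (2 s)². Taking h s = μ ln s and h s = s ln β gives the irrationality exponent
-- and base, and q n lies between F n + b 1 ⋯ b n - 1 and F n b 1 ⋯ b n.
module Submission where

open import Defs
open import Algebra.Bundles using (CommutativeRing)
import Algebra.Properties.Ring as RingProperties
import Algebra.Properties.Semiring.Mult as SemiringMult
import Algebra.Solver.Ring
open import Algebra.Solver.Ring.AlmostCommutativeRing
  using (fromCommutativeRing; _-Raw-AlmostCommutative⟶_)
open import Axiom.ExcludedMiddle using (ExcludedMiddle)
open import Data.Integer.Base as ℤ using (ℤ; +_; -[1+_]) renaming (_*_ to _*ℤ_; _+_ to _+ℤ_)
import Data.Integer.Properties as ℤₚ
import Data.Integer.Tactic.RingSolver as ℤ-Solver
open import Data.Maybe.Base using (Maybe; just; nothing)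
open import Data.Nat.Base as ℕ using (ℕ; zero; suc)
open import Data.Nat.Coprimality using (Coprime; coprime-divisor)
open import Data.Nat.Divisibility using (_∣_; divides; ∣⇒≤; ∣m+n∣m⇒∣n; ∣m⇒∣m*n; ∣n⇒∣m*n; ∣1⇒≡1)
import Data.Nat.Properties as ℕₚ
open import Data.Nat.Tactic.RingSolver using (solve-∀)
open import Data.Product.Base using (∃; _×_; _,_; proj₁; proj₂; ∃-syntax)
open import Data.Sum.Base using (_⊎_; inj₁; inj₂; [_,_]′; swap)
open import Function.Base using (_∘_; _$_)
open import Level using (0ℓ)
open import Relation.Binary.Bundles using (StrictTotalOrder)
import Relation.Binary.Construct.Add.Extrema.NonStrict as AddExtrema
open import Relation.Binary.Definitions using (tri<; tri≈; tri>)
import Relation.Binary.Properties.StrictTotalOrder as STO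
open import Relation.Binary.PropositionalEquality as ≡ using (_≡_)
import Relation.Binary.Reasoning.StrictPartialOrder as SPOReasoning
open import Relation.Nullary.Construct.Add.Extrema using (_±; [_]; ⊥±; ⊤±)
import Relation.Nullary.Construct.Add.Supremum as Sup
open import Relation.Nullary.Decidable.Core using (yes; no)
open import Relation.Nullary.Negation.Core using (¬_; contradiction)
open import Relation.Unary using (Pred)

-- Beyond the estimates, existence has to be settled: `least` returns ∞ unless a least element
-- exists. For the left inequalities ∞ is harmless. For the right ones a finite limsup must produce
-- a finite exponent or base: it makes the set of admissible values nonempty, and the infimum of
-- that set belongs to it because the definition already quantifies over every ε > 0. Legendre's
-- theorem, that a fraction within 1 / (2 s²) is a convergent, is replaced by the weaker bound 1 /
-- (2 s)², obtained by comparing r / s with the single convergent for which q n ≤ 2 s < q (n + 1).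
-- The lost factor enters only as an additive constant beside ln s, and any ε ln s or ε s outgrows
-- it. The same slack absorbs the - 1 in the lower bound for q n: if q n ≤ s, then F n + b 1 ⋯ b n
-- is at most s + 1, hence at most 2 s.

module Continuants where

  -- Continuants over the natural numbers and their Fibonacci bounds.

  open import Data.Nat.Base
  open ≡ using (refl; sym; trans; cong; cong₂; subst)

  -- num c n / den c n = [0; c 0, …, c (n - 1)]
  den num : (ℕ → ℕ) → ℕ → ℕ
  den c zero    = 1
  den c (suc n) = c 0 * den (c ∘ suc) n + num (c ∘ suc) n
  num c zero    = 0
  num c (suc n) = den (c ∘ suc) n

  drop : ℕ → (ℕ → ℕ) → ℕ → ℕ
  drop zero    c = c
  drop (suc n) c = drop n (c ∘ suc)

  drop-0 : ∀ n c → drop n c 0 ≡ c n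
  drop-0 zero    c = refl
  drop-0 (suc n) c = drop-0 n (c ∘ suc)

  drop-pres : ∀ {P : ℕ → Set} n c → (∀ k → P (c k)) → ∀ k → P (drop n c k)
  drop-pres     zero    c Pc = Pc
  drop-pres {P} (suc n) c Pc = drop-pres {P} n (c ∘ suc) (Pc ∘ suc)

  -- Euler's rule: the product of the matrices (c i, 1; 1, 0) is split after the first n + 1
  -- factors. The case k = 1 is the three-term recurrence; general k compares a convergent with all
  -- later ones.
  concat : ∀ n k c → let d = drop (suc n) c in
    den c (suc n + k) ≡ den c (suc n) * den d k + den c n * num d k ×
    num c (suc n + k) ≡ num c (suc n) * den d k + num c n * num d k
  concat zero    k c = lemma₁ (c 0) (den (c ∘ suc) k) (num (c ∘ suc) k) , lemma₂ (den (c ∘ suc) k)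
    where
    lemma₁ : ∀ a D N → a * D + N ≡ (a * 1 + 0) * D + 1 * N
    lemma₁ = solve-∀
    lemma₂ : ∀ D → D ≡ 1 * D + 0
    lemma₂ = solve-∀
  concat (suc n) k c with concat n k (c ∘ suc)
  ... | den-eq , num-eq =
    trans (cong₂ (λ x y → c 0 * x + y) den-eq num-eq)
      (lemma (c 0) (den c′ (suc n)) (den c′ n) (num c′ (suc n)) (num c′ n) (den d k) (num d k)) ,
    den-eq
    where
    c′ = c ∘ suc
    d = drop (suc n) c′
    lemma : ∀ a D₁ D₀ N₁ N₀ D N →
      a * (D₁ * D + D₀ * N) + (N₁ * D + N₀ * N) ≡ (a * D₁ + N₁) * D + (a * D₀ + N₀) * N
    lemma = solve-∀

  -- The definition peels quotients off the front, as `convergent` does; growth estimates need the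
  -- recurrence at the other end.
  den-rec : ∀ n c → den c (2 + n) ≡ c (suc n) * den c (suc n) + den c n
  den-rec n c = subst (λ x → den c (suc x) ≡ c (suc n) * den c (suc n) + den c n) (ℕₚ.+-comm n 1)
    (trans (proj₁ (concat n 1 c))
      (trans (cong (λ x → den c (suc n) * (x * 1 + 0) + den c n * 1) (drop-0 (suc n) c))
        (lemma (den c (suc n)) (c (suc n)) (den c n))))
    where
    lemma : ∀ D a E → D * (a * 1 + 0) + E * 1 ≡ a * D + E
    lemma = solve-∀

  -- Convergents m and n differ by ± d / (den c m * den c n).
  determinant : ∀ n k c → let m = suc n + k ; d = den (drop (suc n) c) k in
    num c m * den c n ≡ num c n * den c m + d ⊎ num c n * den c m ≡ num c m * den c n + d
  determinant zero    k c = inj₁ (ℕₚ.*-identityʳ _)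
  -- Prepending a quotient applies the decreasing map x ↦ 1 / (c 0 + x), so the two alternatives
  -- trade places.
  determinant (suc n) k c =
    swap ([ inj₁ ∘ step (suc n + k) n , inj₂ ∘ step n (suc n + k) ]′ (determinant n k (c ∘ suc)))
    where
    c′ = c ∘ suc
    d = den (drop (suc n) c′) k
    step : ∀ m n → num c′ m * den c′ n ≡ num c′ n * den c′ m + d →
      num c (suc n) * den c (suc m) ≡ num c (suc m) * den c (suc n) + d
    step m n eq = lemma (c 0) (den c′ n) (num c′ n) (den c′ m) (num c′ m) d eq
      where
      lemma : ∀ a Bn An Bm Am d → Am * Bn ≡ An * Bm + d →
        Bn * (a * Bm + Am) ≡ Bm * (a * Bn + An) + d
      lemma a Bn An Bm Am d eq =
        trans (distr a Bn Bm Am) (trans (cong (λ z → a * Bm * Bn + z) eq) (collect a Bn An Bm d))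
        where
        distr : ∀ a Bn Bm Am → Bn * (a * Bm + Am) ≡ a * Bm * Bn + Am * Bn
        distr = solve-∀
        collect : ∀ a Bn An Bm d → a * Bm * Bn + (An * Bm + d) ≡ Bm * (a * Bn + An) + d
        collect = solve-∀

  -- For consecutive convergents, k = 0, the determinant is ± 1, so a common divisor divides 1.
  coprime : ∀ n c → Coprime (den c n) (num c n)
  coprime n c {i} (i∣den , i∣num) = ∣1⇒≡1
    ([ (λ eq → ∣m+n∣m⇒∣n (subst (i ∣_) eq (∣n⇒∣m*n (num c (suc n + 0)) i∣den)) (∣m⇒∣m*n _ i∣num))
     , (λ eq → ∣m+n∣m⇒∣n (subst (i ∣_) eq (∣m⇒∣m*n _ i∣num)) (∣n⇒∣m*n (num c (suc n + 0)) i∣den))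
     ]′ (determinant n 0 c))

  F>0 : ∀ n → 1 ≤ F n
  F>0 zero          = ℕₚ.≤-refl
  F>0 (suc zero)    = ℕₚ.≤-refl
  F>0 (suc (suc n)) = ℕₚ.≤-trans (F>0 (suc n)) (ℕₚ.m≤m+n _ _)

  n≤F : ∀ n → n ≤ F n
  n≤F zero          = z≤n
  n≤F (suc zero)    = ℕₚ.≤-refl
  n≤F (suc (suc n)) =
    ℕₚ.≤-trans (ℕₚ.≤-reflexive (ℕₚ.+-comm 1 (suc n))) (ℕₚ.+-mono-≤ (n≤F (suc n)) (F>0 n))

  ∏ₙ : (ℕ → ℕ) → ℕ → ℕ
  ∏ₙ c zero    = 1
  ∏ₙ c (suc n) = ∏ₙ c n * c n

  module _ (c : ℕ → ℕ) (c>0 : ∀ k → 1 ≤ c k) where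
    open ℕₚ.≤-Reasoning

    den>0 : ∀ n → 1 ≤ den c n
    den-≤ : ∀ n → den c n ≤ den c (suc n)
    den>0 zero    = ℕₚ.≤-refl
    den>0 (suc n) = ℕₚ.≤-trans (den>0 n) (den-≤ n)
    den-≤ zero    =
      ℕₚ.≤-trans (c>0 0) (ℕₚ.≤-trans (ℕₚ.≤-reflexive (sym (ℕₚ.*-identityʳ (c 0)))) (ℕₚ.m≤m+n _ _))
    den-≤ (suc n) = begin
      den c (suc n)                         ≡⟨ ℕₚ.*-identityˡ _ ⟨
      1 * den c (suc n)                     ≤⟨ ℕₚ.*-monoˡ-≤ _ (c>0 (suc n)) ⟩
      c (suc n) * den c (suc n)             ≤⟨ ℕₚ.m≤m+n _ _ ⟩
      c (suc n) * den c (suc n) + den c n   ≡⟨ den-rec n c ⟨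
      den c (2 + n)                         ∎

    den-lower : ∀ n → c n * den c n ≤ den c (suc n)
    den-lower zero    = ℕₚ.m≤m+n _ _
    den-lower (suc n) = ℕₚ.≤-trans (ℕₚ.m≤m+n _ _) (ℕₚ.≤-reflexive (sym (den-rec n c)))

    den-upper : ∀ n → den c (suc n) ≤ c n * den c n + den c n
    den-upper zero    = ℕₚ.+-monoʳ-≤ (c 0 * 1) z≤n
    den-upper (suc n) = ℕₚ.≤-trans (ℕₚ.≤-reflexive (den-rec n c)) (ℕₚ.+-monoʳ-≤ _ (den-≤ n))

    num≤den : ∀ n → num c n ≤ den c n
    num≤den zero    = z≤n
    num≤den (suc n) = begin
      den (c ∘ suc) n                             ≡⟨ ℕₚ.*-identityˡ _ ⟨
      1 * den (c ∘ suc) n                         ≤⟨ ℕₚ.*-monoˡ-≤ _ (c>0 0) ⟩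
      c 0 * den (c ∘ suc) n                       ≤⟨ ℕₚ.m≤m+n _ _ ⟩
      c 0 * den (c ∘ suc) n + num (c ∘ suc) n     ∎

    ∏>0 : ∀ n → 1 ≤ ∏ₙ c n
    ∏>0 zero    = ℕₚ.≤-refl
    ∏>0 (suc n) = ℕₚ.*-mono-≤ (∏>0 n) (c>0 n)

    -- The continuant is a sum of `F n` monomials, each the product of some of the quotients and so
    -- at most the full product.
    den≤F*∏ : ∀ n → den c n ≤ F n * ∏ₙ c n
    den≤F*∏ zero          = ℕₚ.≤-refl
    den≤F*∏ (suc zero)    = ℕₚ.≤-reflexive (lemma (c 0))
      where
      lemma : ∀ a → a * 1 + 0 ≡ 1 * (1 * a)
      lemma = solve-∀
    den≤F*∏ (suc (suc n)) = begin
      den c (2 + n)                               ≡⟨ den-rec n c ⟩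
      b * den c (suc n) + den c n
        ≤⟨ ℕₚ.+-mono-≤ (ℕₚ.*-monoʳ-≤ b (den≤F*∏ (suc n))) (den≤F*∏ n) ⟩
      b * (F (suc n) * (P * a)) + F n * P
        ≤⟨ ℕₚ.+-monoʳ-≤ _ (ℕₚ.*-monoʳ-≤ (F n) (ℕₚ.m≤m*n P (a * b))) ⟩
      b * (F (suc n) * (P * a)) + F n * (P * (a * b)) ≡⟨ lemma (F (suc n)) (F n) P a b ⟩
      (F (suc n) + F n) * (P * a * b)             ∎
      where
      a = c n
      b = c (suc n)
      P = ∏ₙ c n
      instance _ = ℕ.>-nonZero (ℕₚ.*-mono-≤ (c>0 n) (c>0 (suc n)))
      lemma : ∀ F₁ F₀ P a b → b * (F₁ * (P * a)) + F₀ * (P * (a * b)) ≡ (F₁ + F₀) * (P * a * b)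
      lemma = solve-∀

    -- Of the `F n` monomials of the continuant one is the full product, and the other `F n` - 1 are
    -- at least 1.
    F+∏≤1+den : ∀ n → F n + ∏ₙ c n ≤ suc (den c n)
    F+∏≤1+den zero          = ℕₚ.≤-refl
    F+∏≤1+den (suc zero)    = ℕₚ.≤-reflexive (lemma (c 0))
      where
      lemma : ∀ a → 1 + 1 * a ≡ suc (a * 1 + 0)
      lemma = solve-∀
    F+∏≤1+den (suc (suc n)) =
      -- The induction hypotheses with weights `suc b` and 1 leave an excess of `suc b` on the
      -- right. The left side has `b * F₁ + P` to spare, which covers it; hence `suc b` is added to
      -- both sides and cancelled.
      subst (λ x → F (2 + n) + ∏ₙ c (suc n) * x ≤ suc (den c (2 + n))) eq $ ℕₚ.+-cancelʳ-≤ (suc b) _ _ (begin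
      F₁ + F₀ + P * a * suc b + suc b
        ≤⟨ ℕₚ.+-monoʳ-≤ (F₁ + F₀ + P * a * suc b) 1+b≤ ⟩
      F₁ + F₀ + P * a * suc b + (b * F₁ + P)
        ≡⟨ lemma₁ F₁ F₀ P a b ⟩
      suc b * (F₁ + P * a) + (F₀ + P)
        ≤⟨ ℕₚ.+-mono-≤ (ℕₚ.*-monoʳ-≤ (suc b) (F+∏≤1+den (suc n))) (F+∏≤1+den n) ⟩
      suc b * suc D₁ + suc D₀
        ≡⟨ lemma₂ b D₁ D₀ ⟩
      suc (suc b * D₁ + D₀) + suc b
        ≡⟨ cong (λ x → suc (x * D₁ + D₀) + suc b) eq ⟩
      suc (c (suc n) * D₁ + D₀) + suc b
        ≡⟨ cong (λ x → suc x + suc b) (den-rec n c) ⟨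
      suc (den c (2 + n)) + suc b ∎)
      where
      b = pred (c (suc n))
      eq : suc b ≡ c (suc n)
      eq = ℕₚ.suc-pred (c (suc n)) {{>-nonZero (c>0 (suc n))}}
      F₁ = F (suc n)
      F₀ = F n
      P = ∏ₙ c n
      a = c n
      D₁ = den c (suc n)
      D₀ = den c n
      1+b≤ : suc b ≤ b * F₁ + P
      1+b≤ =
        ℕₚ.≤-trans (ℕₚ.≤-reflexive (trans (ℕₚ.+-comm 1 b) (cong (λ z → z + 1) (sym (ℕₚ.*-identityʳ b)))))
        (ℕₚ.+-mono-≤ (ℕₚ.*-monoʳ-≤ b (F>0 (suc n))) (∏>0 n))
      lemma₁ : ∀ F₁ F₀ P a b →
        F₁ + F₀ + P * a * suc b + (b * F₁ + P) ≡ suc b * (F₁ + P * a) + (F₀ + P)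
      lemma₁ = solve-∀
      lemma₂ : ∀ b D₁ D₀ → suc b * suc D₁ + suc D₀ ≡ suc (suc b * D₁ + D₀) + suc b
      lemma₂ = solve-∀

    ≤-den : ∀ n → n ≤ den c n
    ≤-den n = ℕₚ.+-cancelʳ-≤ 1 _ _ (begin
      n + 1              ≤⟨ ℕₚ.+-mono-≤ (n≤F n) (∏>0 n) ⟩
      F n + ∏ₙ c n       ≤⟨ F+∏≤1+den n ⟩
      suc (den c n)      ≡⟨ ℕₚ.+-comm 1 (den c n) ⟩
      den c n + 1        ∎)

    bracket : ∀ x → 1 ≤ x → ∃[ n ] (den c n ≤ x × x < den c (suc n))
    bracket x 1≤x = search (suc x) (≤-den (suc x))
      where
      search : ∀ k → x < den c k → ∃[ n ] (den c n ≤ x × x < den c (suc n))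
      search zero    x<1 = contradiction x<1 (ℕₚ.≤⇒≯ 1≤x)
      search (suc k) x<  with x ℕₚ.<? den c k
      ... | yes x<′ = search k x<′
      ... | no  x≮  = k , ℕₚ.≮⇒≥ x≮ , x<

    den-mono : ∀ {m n} → m ≤ n → den c m ≤ den c n
    den-mono {n = zero}  z≤n = ℕₚ.≤-refl
    den-mono {m} {suc n} m≤n with ℕₚ.m≤n⇒m<n∨m≡n m≤n
    ... | inj₁ m<n  = ℕₚ.≤-trans (den-mono (ℕₚ.≤-pred m<n)) (den-≤ n)
    ... | inj₂ refl = ℕₚ.≤-refl

    -- The second factor is at most (c n + 2) den c n ≤ 3 c n den c n. The 3 is rounded up to 4 to
    -- agree with the bound for fractions that are not convergents.
    den-product-upper : ∀ n s → den c n ≤ s →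
      den c n * (den c (suc n) + den c n) ≤ 4 * (s * s) * c n
    den-product-upper n s q≤s = begin
      q * (den c (suc n) + q)
        ≤⟨ ℕₚ.*-monoʳ-≤ q (ℕₚ.+-monoˡ-≤ q (den-upper n)) ⟩
      q * (c n * q + q + q)                         ≡⟨ lemma₁ q (c n) ⟩
      q * q * (c n + 2)
        ≤⟨ ℕₚ.*-mono-≤ (ℕₚ.*-mono-≤ q≤s q≤s) (ℕₚ.+-monoʳ-≤ (c n) (ℕₚ.*-monoʳ-≤ 2 (c>0 n))) ⟩
      s * s * (c n + 2 * c n)                       ≤⟨ ℕₚ.m≤m+n _ (s * s * c n) ⟩
      s * s * (c n + 2 * c n) + s * s * c n         ≡⟨ lemma₂ s (c n) ⟩
      4 * (s * s) * c n                             ∎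
      where
      q = den c n
      lemma₁ : ∀ q c → q * (c * q + q + q) ≡ q * q * (c + 2)
      lemma₁ = solve-∀
      lemma₂ : ∀ s c → s * s * (c + 2 * c) + s * s * c ≡ 4 * (s * s) * c
      lemma₂ = solve-∀

    -- Cancels the determinant `den d k` from the difference of two convergents: the resulting bound
    -- depends on n alone and survives the limit k → ∞. The upper bound below serves the same
    -- purpose.
    den-concat-lower : ∀ n k → den c (suc n) * den (drop (suc n) c) k ≤ den c (suc n + k)
    den-concat-lower n k = begin
      den c (suc n) * den d k                       ≤⟨ ℕₚ.m≤m+n _ _ ⟩
      den c (suc n) * den d k + den c n * num d k   ≡⟨ proj₁ (concat n k c) ⟨
      den c (suc n + k)                             ∎
      where d = drop (suc n) c

  den-concat-upper : ∀ c → (∀ k → 1 ≤ c k) → ∀ n k →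
    den c (suc n + k) ≤ (den c (suc n) + den c n) * den (drop (suc n) c) k
  den-concat-upper c c>0 n k = begin
    den c (suc n + k)                             ≡⟨ proj₁ (concat n k c) ⟩
    den c (suc n) * den d k + den c n * num d k   ≤⟨ ℕₚ.+-monoʳ-≤ _ (ℕₚ.*-monoʳ-≤ (den c n)
                                                      (num≤den d (drop-pres {1 ≤_} (suc n) c c>0) k)) ⟩
    den c (suc n) * den d k + den c n * den d k
      ≡⟨ ℕₚ.*-distribʳ-+ (den d k) (den c (suc n)) (den c n) ⟨
    (den c (suc n) + den c n) * den d k           ∎
    where
    open ℕₚ.≤-Reasoning
    d = drop (suc n) c

-- Ordered field arithmetic, embedding of the integers, absolute value.

module OrderedField (ℝ : RealNumbers) where
  open RealNumbers ℝ public
  open CommutativeRing commutativeRing public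
    using (refl; sym; trans; +-cong; +-congˡ; +-congʳ; *-cong; *-congˡ; *-congʳ; -‿cong
          ; +-assoc; +-comm; +-identityˡ; +-identityʳ; *-assoc; *-comm; *-identityˡ; *-identityʳ
          ; -‿inverseʳ; -‿inverseˡ; zeroˡ; zeroʳ; ring; semiring)

  strictTotalOrder : StrictTotalOrder _ _ _
  strictTotalOrder = record { isStrictTotalOrder = isStrictTotalOrder }

  open StrictTotalOrder strictTotalOrder public
    using (irrefl; asym; compare; <-respʳ-≈; strictPartialOrder)
    renaming (trans to <-trans)
  open STO strictTotalOrder public using ()
    renaming (trans to ≤-trans; refl to ≤-refl; reflexive to ≤-reflexive; antisym to ≤-antisym)
  module Reasoning = SPOReasoning strictPartialOrder
  open Reasoning

  module RP = RingProperties ring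
  module SM = SemiringMult semiring

  fromℕ-+ : ∀ m n → fromℕ (m ℕ.+ n) ≈ fromℕ m + fromℕ n
  fromℕ-+ = SM.×-homo-+ 1#

  fromℕ-* : ∀ m n → fromℕ (m ℕ.* n) ≈ fromℕ m * fromℕ n
  fromℕ-* = SM.×1-homo-*

  fromℤ-neg : ∀ i → fromℤ (ℤ.- i) ≈ - fromℤ i
  fromℤ-neg (+ zero)  = sym RP.-0#≈0#
  fromℤ-neg (+ suc n) = refl
  fromℤ-neg -[1+ n ]  = sym (RP.-‿involutive _)

  fromℤ-⊖ : ∀ m n → fromℤ (m ℤ.⊖ n) ≈ fromℕ m - fromℕ n
  fromℤ-⊖ zero    zero    = sym (-‿inverseʳ 0#)
  fromℤ-⊖ zero    (suc n) = sym (+-identityˡ _)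
  fromℤ-⊖ (suc m) zero    = sym (trans (+-congˡ RP.-0#≈0#) (+-identityʳ _))
  fromℤ-⊖ (suc m) (suc n) = begin-equality
    fromℤ (suc m ℤ.⊖ suc n)                   ≡⟨ ≡.cong fromℤ (ℤₚ.[1+m]⊖[1+n]≡m⊖n m n) ⟩
    fromℤ (m ℤ.⊖ n)                           ≈⟨ fromℤ-⊖ m n ⟩
    fromℕ m - fromℕ n                         ≈⟨ +-congʳ (+-identityˡ _) ⟨
    0# + fromℕ m - fromℕ n                    ≈⟨ +-congʳ (+-congʳ (-‿inverseˡ 1#)) ⟨
    - 1# + 1# + fromℕ m - fromℕ n             ≈⟨ +-congʳ (+-assoc _ _ _) ⟩
    - 1# + fromℕ (suc m) - fromℕ n            ≈⟨ +-congʳ (+-comm _ _) ⟩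
    fromℕ (suc m) - 1# - fromℕ n              ≈⟨ +-assoc _ _ _ ⟩
    fromℕ (suc m) + (- 1# - fromℕ n)          ≈⟨ +-congˡ (RP.-‿+-comm 1# (fromℕ n)) ⟩
    fromℕ (suc m) - fromℕ (suc n)             ∎

  fromℤ-+ : ∀ i j → fromℤ (i ℤ.+ j) ≈ fromℤ i + fromℤ j
  fromℤ-+ (+ m)      (+ n)      = fromℕ-+ m n
  fromℤ-+ (+ m)      (-[1+ n ]) = fromℤ-⊖ m (suc n)
  fromℤ-+ (-[1+ m ]) (+ n)      = trans (fromℤ-⊖ n (suc m)) (+-comm _ _)
  fromℤ-+ (-[1+ m ]) (-[1+ n ]) = begin-equality
    - fromℕ (suc (suc (m ℕ.+ n)))       ≡⟨ ≡.cong (λ k → - fromℕ k) (≡.sym (ℕₚ.+-suc (suc m) n)) ⟩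
    - fromℕ (suc m ℕ.+ suc n)           ≈⟨ -‿cong (fromℕ-+ (suc m) (suc n)) ⟩
    - (fromℕ (suc m) + fromℕ (suc n))   ≈⟨ RP.-‿+-comm _ _ ⟨
    - fromℕ (suc m) - fromℕ (suc n)     ∎

  fromℤ-* : ∀ i j → fromℤ (i ℤ.* j) ≈ fromℤ i * fromℤ j
  fromℤ-*-+ : ∀ m j → fromℤ (+ m ℤ.* j) ≈ fromℕ m * fromℤ j
  fromℤ-*-+ m (+ n)    = trans (reflexive (≡.cong fromℤ (≡.sym (ℤₚ.pos-* m n)))) (fromℕ-* m n)
    where open CommutativeRing commutativeRing using (reflexive)
  fromℤ-*-+ m -[1+ n ] = begin-equality
    fromℤ (+ m ℤ.* -[1+ n ])         ≡⟨ ≡.cong fromℤ (ℤₚ.neg-distribʳ-* (+ m) (+ suc n)) ⟨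
    fromℤ (ℤ.- (+ m ℤ.* + suc n))    ≈⟨ fromℤ-neg (+ m ℤ.* + suc n) ⟩
    - fromℤ (+ m ℤ.* + suc n)        ≈⟨ -‿cong (fromℤ-*-+ m (+ suc n)) ⟩
    - (fromℕ m * fromℕ (suc n))      ≈⟨ RP.-‿distribʳ-* _ _ ⟩
    fromℕ m * - fromℕ (suc n)        ∎
  fromℤ-* (+ m)    j = fromℤ-*-+ m j
  fromℤ-* -[1+ m ] j = begin-equality
    fromℤ (-[1+ m ] ℤ.* j)           ≡⟨ ≡.cong fromℤ (ℤₚ.neg-distribˡ-* (+ suc m) j) ⟨
    fromℤ (ℤ.- (+ suc m ℤ.* j))      ≈⟨ fromℤ-neg (+ suc m ℤ.* j) ⟩
    - fromℤ (+ suc m ℤ.* j)          ≈⟨ -‿cong (fromℤ-*-+ (suc m) j) ⟩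
    - (fromℕ (suc m) * fromℤ j)      ≈⟨ RP.-‿distribˡ-* _ _ ⟩
    - fromℕ (suc m) * fromℤ j        ∎

  -- Integer coefficients for the ring solver: their equality computes, and `con (+ 2)` evaluates to
  -- `2#`.
  fromℤ-morphism : ℤ.+-*-rawRing -Raw-AlmostCommutative⟶ fromCommutativeRing commutativeRing
  fromℤ-morphism = record
    { ⟦_⟧    = fromℤ
    ; +-homo = fromℤ-+
    ; *-homo = fromℤ-*
    ; -‿homo = fromℤ-neg
    ; 0-homo = refl
    ; 1-homo = +-identityʳ 1#
    }

  fromℤ-≟ : ∀ i j → Maybe (fromℤ i ≈ fromℤ j)
  fromℤ-≟ i j with i ℤₚ.≟ j
  ... | yes ≡.refl = just refl
  ... | no  _      = nothing

  open Algebra.Solver.Ring ℤ.+-*-rawRing (fromCommutativeRing commutativeRing)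
    fromℤ-morphism fromℤ-≟ public using (solve; _:=_; _:+_; _:*_; _:-_; :-_; con)

  ≮⇒≥ : ∀ {x y} → ¬ x < y → y ≤ x
  ≮⇒≥ {x} {y} x≮y with compare x y
  ... | tri< x<y _ _ = contradiction x<y x≮y
  ... | tri≈ _ x≈y _ = ≤-reflexive (sym x≈y)
  ... | tri> _ _ y<x = inj₁ y<x

  ≤⇒≯ : ∀ {x y} → x ≤ y → ¬ y < x
  ≤⇒≯ (inj₁ x<y) y<x = asym x<y y<x
  ≤⇒≯ (inj₂ x≈y) y<x = irrefl (sym x≈y) y<x

  ≰⇒> : ∀ {x y} → ¬ x ≤ y → y < x
  ≰⇒> {x} {y} x≰y with compare x y
  ... | tri< x<y _ _ = contradiction (inj₁ x<y) x≰y
  ... | tri≈ _ x≈y _ = contradiction (inj₂ x≈y) x≰y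
  ... | tri> _ _ y<x = y<x

  <-≤-trans : ∀ {x y z} → x < y → y ≤ z → x < z
  <-≤-trans {x} {y} {z} x<y y≤z = begin-strict x <⟨ x<y ⟩ y ≤⟨ y≤z ⟩ z ∎

  ≤-<-trans : ∀ {x y z} → x ≤ y → y < z → x < z
  ≤-<-trans {x} {y} {z} x≤y y<z = begin-strict x ≤⟨ x≤y ⟩ y <⟨ y<z ⟩ z ∎

  +-monoˡ-< : ∀ x {y z} → y < z → y + x < z + x
  +-monoˡ-< x {y} {z} y<z = begin-strict
    y + x   ≈⟨ +-comm y x ⟩
    x + y   <⟨ +-monoʳ-< x y<z ⟩
    x + z   ≈⟨ +-comm x z ⟩
    z + x   ∎

  +-monoʳ-≤ : ∀ x {y z} → y ≤ z → x + y ≤ x + z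
  +-monoʳ-≤ x (inj₁ y<z) = inj₁ (+-monoʳ-< x y<z)
  +-monoʳ-≤ x (inj₂ y≈z) = inj₂ (+-congˡ y≈z)

  +-monoˡ-≤ : ∀ x {y z} → y ≤ z → y + x ≤ z + x
  +-monoˡ-≤ x (inj₁ y<z) = inj₁ (+-monoˡ-< x y<z)
  +-monoˡ-≤ x (inj₂ y≈z) = inj₂ (+-congʳ y≈z)

  +-mono-≤ : ∀ {w x y z} → w ≤ x → y ≤ z → w + y ≤ x + z
  +-mono-≤ {x = x} {y} w≤x y≤z = ≤-trans (+-monoˡ-≤ y w≤x) (+-monoʳ-≤ x y≤z)

  +-cancelʳ-< : ∀ x {y z} → y + x < z + x → y < z
  +-cancelʳ-< x y+x<z+x = ≰⇒> λ z≤y → ≤⇒≯ (+-monoˡ-≤ x z≤y) y+x<z+x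

  +-cancelʳ-≤ : ∀ x {y z} → y + x ≤ z + x → y ≤ z
  +-cancelʳ-≤ x y+x≤z+x = ≮⇒≥ λ z<y → ≤⇒≯ y+x≤z+x (+-monoˡ-< x z<y)

  x<x+ε : ∀ {x ε} → 0# < ε → x < x + ε
  x<x+ε {x} {ε} 0<ε = begin-strict
    x        ≈⟨ +-identityʳ x ⟨
    x + 0#   <⟨ +-monoʳ-< x 0<ε ⟩
    x + ε    ∎

  x<y⇒0<y-x : ∀ {x y} → x < y → 0# < y - x
  x<y⇒0<y-x {x} {y} x<y = begin-strict
    0#      ≈⟨ -‿inverseʳ x ⟨
    x - x   <⟨ +-monoˡ-< (- x) x<y ⟩
    y - x   ∎

  neg-mono-< : ∀ {x y} → x < y → - y < - x
  neg-mono-< {x} {y} x<y = +-cancelʳ-< (x + y) (begin-strict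
    - y + (x + y)   ≈⟨ solve 2 (λ x y → :- y :+ (x :+ y) := x) refl x y ⟩
    x               <⟨ x<y ⟩
    y               ≈⟨ solve 2 (λ x y → :- x :+ (x :+ y) := y) refl x y ⟨
    - x + (x + y)   ∎)

  neg-mono-≤ : ∀ {x y} → x ≤ y → - y ≤ - x
  neg-mono-≤ (inj₁ x<y) = inj₁ (neg-mono-< x<y)
  neg-mono-≤ (inj₂ x≈y) = inj₂ (-‿cong (sym x≈y))

  +-pos : ∀ {x y} → 0# < x → 0# < y → 0# < x + y
  +-pos 0<x 0<y = <-trans 0<x (x<x+ε 0<y)

  +-nonneg : ∀ {x y} → 0# ≤ x → 0# ≤ y → 0# ≤ x + y
  +-nonneg 0≤x 0≤y = ≤-trans (≤-reflexive (sym (+-identityʳ 0#))) (+-mono-≤ 0≤x 0≤y)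

  *-monoʳ-< : ∀ {x y z} → 0# < x → y < z → x * y < x * z
  *-monoʳ-< {x} {y} {z} 0<x y<z = +-cancelʳ-< (- (x * y)) (begin-strict
    x * y - x * y   ≈⟨ -‿inverseʳ _ ⟩
    0#              <⟨ *-pos 0<x (x<y⇒0<y-x y<z) ⟩
    x * (z - y)     ≈⟨ solve 3 (λ x y z → x :* (z :- y) := x :* z :- x :* y) refl x y z ⟩
    x * z - x * y   ∎)

  *-monoʳ-≤ : ∀ {x y z} → 0# ≤ x → y ≤ z → x * y ≤ x * z
  *-monoʳ-≤ (inj₁ 0<x) (inj₁ y<z) = inj₁ (*-monoʳ-< 0<x y<z)
  *-monoʳ-≤ {y = y} {z} (inj₂ 0≈x) _ =
    inj₂ (trans (*-congʳ (sym 0≈x)) (trans (zeroˡ y) (trans (sym (zeroˡ z)) (*-congʳ 0≈x))))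
  *-monoʳ-≤ _          (inj₂ y≈z) = inj₂ (*-congˡ y≈z)

  *-monoˡ-< : ∀ {x y z} → 0# < x → y < z → y * x < z * x
  *-monoˡ-< {x} {y} {z} 0<x y<z = begin-strict
    y * x   ≈⟨ *-comm y x ⟩
    x * y   <⟨ *-monoʳ-< 0<x y<z ⟩
    x * z   ≈⟨ *-comm x z ⟩
    z * x   ∎

  *-monoˡ-≤ : ∀ {x y z} → 0# ≤ x → y ≤ z → y * x ≤ z * x
  *-monoˡ-≤ {x} {y} {z} 0≤x y≤z = begin
    y * x   ≈⟨ *-comm y x ⟩
    x * y   ≤⟨ *-monoʳ-≤ 0≤x y≤z ⟩
    x * z   ≈⟨ *-comm x z ⟩
    z * x   ∎

  *-nonneg : ∀ {x y} → 0# ≤ x → 0# ≤ y → 0# ≤ x * y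
  *-nonneg {x} {y} 0≤x 0≤y = begin
    0#       ≈⟨ zeroʳ x ⟨
    x * 0#   ≤⟨ *-monoʳ-≤ 0≤x 0≤y ⟩
    x * y    ∎

  *-cancelˡ-≤ : ∀ {x y z} → 0# < x → x * y ≤ x * z → y ≤ z
  *-cancelˡ-≤ 0<x xy≤xz = ≮⇒≥ λ z<y → ≤⇒≯ xy≤xz (*-monoʳ-< 0<x z<y)

  *-cancelˡ-< : ∀ {x y z} → 0# ≤ x → x * y < x * z → y < z
  *-cancelˡ-< 0≤x xy<xz = ≰⇒> λ z≤y → ≤⇒≯ (*-monoʳ-≤ 0≤x z≤y) xy<xz

  >⇒≉ : ∀ {x y} → x < y → ¬ y ≈ x
  >⇒≉ x<y y≈x = irrefl (sym y≈x) x<y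

  *-inverse : ∀ {x} → 0# < x → x * x ⁻¹ ≈ 1#
  *-inverse 0<x = *-inverseʳ (>⇒≉ 0<x)

  ⁻¹-pos : ∀ {x} → 0# < x → 0# < x ⁻¹
  ⁻¹-pos {x} 0<x = *-cancelˡ-< (inj₁ 0<x) (begin-strict
    x * 0#     ≈⟨ zeroʳ x ⟩
    0#         <⟨ 0<1 ⟩
    1#         ≈⟨ *-inverse 0<x ⟨
    x * x ⁻¹   ∎)

  /-cancel : ∀ {x y} → 0# < y → x / y * y ≈ x
  /-cancel {x} {y} 0<y = begin-equality
    x * y ⁻¹ * y     ≈⟨ solve 3 (λ x y z → x :* z :* y := x :* (y :* z)) refl x y (y ⁻¹) ⟩
    x * (y * y ⁻¹)   ≈⟨ *-congˡ (*-inverse 0<y) ⟩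
    x * 1#           ≈⟨ *-identityʳ x ⟩
    x                ∎

  *-cancelʳ-≈ : ∀ {x y z} → 0# < z → x * z ≈ y * z → x ≈ y
  *-cancelʳ-≈ {x} {y} {z} 0<z xz≈yz = begin-equality
    x              ≈⟨ *-identityʳ x ⟨
    x * 1#         ≈⟨ *-congˡ (*-inverse 0<z) ⟨
    x * (z * z ⁻¹) ≈⟨ *-assoc x z (z ⁻¹) ⟨
    x * z * z ⁻¹   ≈⟨ *-congʳ xz≈yz ⟩
    y * z * z ⁻¹   ≈⟨ *-assoc y z (z ⁻¹) ⟩
    y * (z * z ⁻¹) ≈⟨ *-congˡ (*-inverse 0<z) ⟩
    y * 1#         ≈⟨ *-identityʳ y ⟩
    y              ∎

  x≤yz⇒x/z≤y : ∀ {x y z} → 0# < z → x ≤ y * z → x / z ≤ y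
  x≤yz⇒x/z≤y {x} {y} {z} 0<z x≤yz = *-cancelˡ-≤ 0<z (begin
    z * (x / z)   ≈⟨ *-comm z _ ⟩
    x / z * z     ≈⟨ /-cancel 0<z ⟩
    x             ≤⟨ x≤yz ⟩
    y * z         ≈⟨ *-comm y z ⟩
    z * y         ∎)

  x/z≤y⇒x≤yz : ∀ {x y z} → 0# < z → x / z ≤ y → x ≤ y * z
  x/z≤y⇒x≤yz {x} {y} {z} 0<z x/z≤y = begin
    x           ≈⟨ /-cancel 0<z ⟨
    x / z * z   ≤⟨ *-monoˡ-≤ (inj₁ 0<z) x/z≤y ⟩
    y * z       ∎

  xz≤y⇒x≤y/z : ∀ {x y z} → 0# < z → x * z ≤ y → x ≤ y / z
  xz≤y⇒x≤y/z {x} {y} {z} 0<z xz≤y = *-cancelˡ-≤ 0<z (begin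
    z * x         ≈⟨ *-comm z x ⟩
    x * z         ≤⟨ xz≤y ⟩
    y             ≈⟨ /-cancel 0<z ⟨
    y / z * z     ≈⟨ *-comm _ z ⟩
    z * (y / z)   ∎)

  x≤y/z⇒xz≤y : ∀ {x y z} → 0# < z → x ≤ y / z → x * z ≤ y
  x≤y/z⇒xz≤y {x} {y} {z} 0<z x≤y/z = begin
    x * z       ≤⟨ *-monoˡ-≤ (inj₁ 0<z) x≤y/z ⟩
    y / z * z   ≈⟨ /-cancel 0<z ⟩
    y           ∎

  2# : Carrier
  2# = fromℕ 2

  half : Carrier → Carrier
  half x = x / 2#

  0<2 : 0# < 2#
  0<2 = +-pos 0<1 (<-respʳ-≈ (sym (+-identityʳ 1#)) 0<1)

  half+half : ∀ x → half x + half x ≈ x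
  half+half x = trans (solve 1 (λ h → h :+ h := h :* con (+ 2)) refl (half x)) (/-cancel 0<2)

  half-pos : ∀ {x} → 0# < x → 0# < half x
  half-pos 0<x = *-pos 0<x (⁻¹-pos 0<2)

  ≤-by-ε : ∀ {x y} → (∀ ε → 0# < ε → x ≤ y + ε) → x ≤ y
  ≤-by-ε {x} {y} x≤y+ε = ≮⇒≥ λ y<x →
    let h = half (x - y) ; 0<h = half-pos (x<y⇒0<y-x y<x) in
    ≤⇒≯ (x≤y+ε h 0<h) (begin-strict
      y + h         <⟨ +-monoʳ-< y (x<x+ε 0<h) ⟩
      y + (h + h)   ≈⟨ +-congˡ (half+half (x - y)) ⟩
      y + (x - y)   ≈⟨ solve 2 (λ x y → y :+ (x :- y) := x) refl x y ⟩
      x             ∎)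

  fromℕ-nonneg : ∀ n → 0# ≤ fromℕ n
  fromℕ-nonneg zero    = ≤-refl
  fromℕ-nonneg (suc n) = begin
    0#             ≤⟨ +-nonneg (inj₁ 0<1) (fromℕ-nonneg n) ⟩
    1# + fromℕ n   ∎

  fromℕ-mono-≤ : ∀ {m n} → m ℕ.≤ n → fromℕ m ≤ fromℕ n
  fromℕ-mono-≤ {n = n} ℕ.z≤n = fromℕ-nonneg n
  fromℕ-mono-≤ (ℕ.s≤s m≤n) = +-monoʳ-≤ 1# (fromℕ-mono-≤ m≤n)

  fromℕ-mono-< : ∀ {m n} → m ℕ.< n → fromℕ m < fromℕ n
  fromℕ-mono-< {m} {n} m<n = begin-strict
    fromℕ m        ≈⟨ +-identityˡ _ ⟨
    0# + fromℕ m   <⟨ +-monoˡ-< (fromℕ m) 0<1 ⟩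
    1# + fromℕ m   ≤⟨ fromℕ-mono-≤ m<n ⟩
    fromℕ n        ∎

  1≈fromℕ1 : 1# ≈ fromℕ 1
  1≈fromℕ1 = sym (+-identityʳ 1#)

  1≤fromℕ : ∀ {n} → 1 ℕ.≤ n → 1# ≤ fromℕ n
  1≤fromℕ {n} 1≤n = ≤-trans (≤-reflexive 1≈fromℕ1) (fromℕ-mono-≤ 1≤n)

  fromℕ-pos : ∀ {n} → 1 ℕ.≤ n → 0# < fromℕ n
  fromℕ-pos 1≤n = <-≤-trans 0<1 (1≤fromℕ 1≤n)

  ∣∣-cases : ∀ x → (0# ≤ x × ∣ x ∣ ≡ x) ⊎ (x < 0# × ∣ x ∣ ≡ - x)
  ∣∣-cases x with x <? 0#
  ... | yes x<0 = inj₂ (x<0 , ≡.refl)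
  ... | no  x≮0 = inj₁ (≮⇒≥ x≮0 , ≡.refl)

  0≤x⇒-x≤0 : ∀ {x} → 0# ≤ x → - x ≤ 0#
  0≤x⇒-x≤0 {x} 0≤x = ≤-trans (neg-mono-≤ 0≤x) (≤-reflexive RP.-0#≈0#)

  x<0⇒0<-x : ∀ {x} → x < 0# → 0# < - x
  x<0⇒0<-x {x} x<0 = ≤-<-trans (≤-reflexive (sym RP.-0#≈0#)) (neg-mono-< x<0)

  0≤∣x∣ : ∀ x → 0# ≤ ∣ x ∣
  0≤∣x∣ x with ∣∣-cases x
  ... | inj₁ (0≤x , eq) rewrite eq = 0≤x
  ... | inj₂ (x<0 , eq) rewrite eq = inj₁ (x<0⇒0<-x x<0)

  x≤∣x∣ : ∀ x → x ≤ ∣ x ∣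
  x≤∣x∣ x with ∣∣-cases x
  ... | inj₁ (0≤x , eq) rewrite eq = ≤-refl
  ... | inj₂ (x<0 , eq) = ≤-trans (inj₁ x<0) (0≤∣x∣ x)

  -x≤∣x∣ : ∀ x → - x ≤ ∣ x ∣
  -x≤∣x∣ x with ∣∣-cases x
  ... | inj₁ (0≤x , eq) = ≤-trans (0≤x⇒-x≤0 0≤x) (0≤∣x∣ x)
  ... | inj₂ (x<0 , eq) rewrite eq = ≤-refl

  ∣∣-least : ∀ {x y} → x ≤ y → - x ≤ y → ∣ x ∣ ≤ y
  ∣∣-least {x} x≤y -x≤y with ∣∣-cases x
  ... | inj₁ (_ , eq) rewrite eq = x≤y
  ... | inj₂ (_ , eq) rewrite eq = -x≤y

  ∣∣-cong-≤ : ∀ {x y} → x ≈ y → ∣ x ∣ ≤ ∣ y ∣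
  ∣∣-cong-≤ {x} {y} x≈y =
    ∣∣-least (≤-trans (≤-reflexive x≈y) (x≤∣x∣ y)) (≤-trans (≤-reflexive (-‿cong x≈y)) (-x≤∣x∣ y))

  ∣∣-cong : ∀ {x y} → x ≈ y → ∣ x ∣ ≈ ∣ y ∣
  ∣∣-cong x≈y = ≤-antisym (∣∣-cong-≤ x≈y) (∣∣-cong-≤ (sym x≈y))

  ∣-x∣≤∣x∣ : ∀ x → ∣ - x ∣ ≤ ∣ x ∣
  ∣-x∣≤∣x∣ x = ∣∣-least (-x≤∣x∣ x) (≤-trans (≤-reflexive (RP.-‿involutive x)) (x≤∣x∣ x))

  dist-sym : ∀ x y → ∣ x - y ∣ ≤ ∣ y - x ∣
  dist-sym x y = begin
    ∣ x - y ∣       ≈⟨ ∣∣-cong (solve 2 (λ x y → x :- y := :- (y :- x)) refl x y) ⟩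
    ∣ - (y - x) ∣   ≤⟨ ∣-x∣≤∣x∣ (y - x) ⟩
    ∣ y - x ∣       ∎

  dist-triangle : ∀ x y z → ∣ x - z ∣ ≤ ∣ x - y ∣ + ∣ y - z ∣
  dist-triangle x y z = ∣∣-least
    (begin
      x - z                 ≈⟨ solve 3 (λ x y z → x :- z := (x :- y) :+ (y :- z)) refl x y z ⟩
      (x - y) + (y - z)     ≤⟨ +-mono-≤ (x≤∣x∣ _) (x≤∣x∣ _) ⟩
      ∣ x - y ∣ + ∣ y - z ∣ ∎)
    (begin
      - (x - z)
        ≈⟨ solve 3 (λ x y z → :- (x :- z) := :- (x :- y) :+ :- (y :- z)) refl x y z ⟩
      - (x - y) + - (y - z)     ≤⟨ +-mono-≤ (-x≤∣x∣ _) (-x≤∣x∣ _) ⟩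
      ∣ x - y ∣ + ∣ y - z ∣ ∎)

  ∣∣-* : ∀ x {y} → 0# ≤ y → ∣ x * y ∣ ≈ ∣ x ∣ * y
  ∣∣-* x {y} 0≤y with ∣∣-cases x
  ... | inj₁ (0≤x , eq) rewrite eq = ≤-antisym
    (∣∣-least ≤-refl (≤-trans (0≤x⇒-x≤0 0≤xy) 0≤xy)) (x≤∣x∣ _)
    where 0≤xy = *-nonneg 0≤x 0≤y
  ... | inj₂ (x<0 , eq) rewrite eq = ≤-antisym
    (∣∣-least (+-cancelʳ-≤ (- x * y) (begin
        x * y + - x * y     ≈⟨ solve 2 (λ x y → x :* y :+ (:- x) :* y := con (+ 0)) refl x y ⟩
        0#                  ≤⟨ *-nonneg 0≤-x 0≤y ⟩
        - x * y             ≈⟨ +-identityˡ _ ⟨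
        0# + - x * y        ≤⟨ +-monoˡ-≤ _ (*-nonneg 0≤-x 0≤y) ⟩
        - x * y + - x * y   ∎))
      (≤-reflexive (RP.-‿distribˡ-* x y)))
    (≤-trans (≤-reflexive (sym (RP.-‿distribˡ-* x y))) (-x≤∣x∣ (x * y)))
    where 0≤-x = inj₁ (x<0⇒0<-x x<0)

  1≤∣fromℤ∣ : ∀ i → ¬ i ≡ + 0 → 1# ≤ ∣ fromℤ i ∣
  1≤∣fromℤ∣ (+ zero)  i≢0 = contradiction ≡.refl i≢0
  1≤∣fromℤ∣ (+ suc n) i≢0 = ≤-trans (1≤fromℕ {suc n} (ℕ.s≤s ℕ.z≤n)) (x≤∣x∣ (fromℕ (suc n)))
  1≤∣fromℤ∣ -[1+ n ]  i≢0 = begin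
    1#                    ≤⟨ 1≤fromℕ {suc n} (ℕ.s≤s ℕ.z≤n) ⟩
    fromℕ (suc n)         ≈⟨ RP.-‿involutive _ ⟨
    - - fromℕ (suc n)     ≤⟨ -x≤∣x∣ _ ⟩
    ∣ - fromℕ (suc n) ∣   ∎

-- Exponential and logarithm, from the functional equation and 1 + x ≤ exp x.

module ExpLn (ℝ : RealNumbers) where
  open OrderedField ℝ
  open Reasoning

  1<exp : ∀ {x} → 0# < x → 1# < exp x
  1<exp {x} 0<x = <-≤-trans (x<x+ε 0<x) (1+x≤exp x)

  1≤exp : ∀ {x} → 0# ≤ x → 1# ≤ exp x
  1≤exp {x} 0≤x = begin
    1#        ≈⟨ +-identityʳ 1# ⟨
    1# + 0#   ≤⟨ +-monoʳ-≤ 1# 0≤x ⟩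
    1# + x    ≤⟨ 1+x≤exp x ⟩
    exp x     ∎

  exp-0 : exp 0# ≈ 1#
  exp-0 = *-cancelʳ-≈ (<-≤-trans 0<1 (1≤exp ≤-refl)) (begin-equality
    exp 0# * exp 0#   ≈⟨ exp-+ 0# 0# ⟨
    exp (0# + 0#)     ≈⟨ exp-cong (+-identityʳ 0#) ⟩
    exp 0#            ≈⟨ *-identityˡ _ ⟨
    1# * exp 0#       ∎)

  exp-neg-inverse : ∀ x → exp (- x) * exp x ≈ 1#
  exp-neg-inverse x = trans (sym (exp-+ (- x) x)) (trans (exp-cong (-‿inverseˡ x)) exp-0)

  0<exp : ∀ x → 0# < exp x
  0<exp x with x <? 0#
  ... | no x≮0  = <-≤-trans 0<1 (1≤exp (≮⇒≥ x≮0))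
  ... | yes x<0 = *-cancelˡ-< (inj₁ (<-≤-trans 0<1 (1≤exp (inj₁ (x<0⇒0<-x x<0))))) (begin-strict
    exp (- x) * 0#      ≈⟨ zeroʳ _ ⟩
    0#                  <⟨ 0<1 ⟩
    1#                  ≈⟨ exp-neg-inverse x ⟨
    exp (- x) * exp x   ∎)

  exp-mono-< : ∀ {x y} → x < y → exp x < exp y
  exp-mono-< {x} {y} x<y = begin-strict
    exp x                 ≈⟨ *-identityʳ _ ⟨
    exp x * 1#            <⟨ *-monoʳ-< (0<exp x) (1<exp (x<y⇒0<y-x x<y)) ⟩
    exp x * exp (y - x)   ≈⟨ exp-+ x (y - x) ⟨
    exp (x + (y - x))     ≈⟨ exp-cong (solve 2 (λ x y → x :+ (y :- x) := y) refl x y) ⟩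
    exp y                 ∎

  exp-mono-≤ : ∀ {x y} → x ≤ y → exp x ≤ exp y
  exp-mono-≤ (inj₁ x<y) = inj₁ (exp-mono-< x<y)
  exp-mono-≤ (inj₂ x≈y) = inj₂ (exp-cong x≈y)

  exp-cancel-< : ∀ {x y} → exp x < exp y → x < y
  exp-cancel-< ex<ey = ≰⇒> λ y≤x → ≤⇒≯ (exp-mono-≤ y≤x) ex<ey

  exp-cancel-≤ : ∀ {x y} → exp x ≤ exp y → x ≤ y
  exp-cancel-≤ ex≤ey = ≮⇒≥ λ y<x → ≤⇒≯ ex≤ey (exp-mono-< y<x)

  exp-injective : ∀ {x y} → exp x ≈ exp y → x ≈ y
  exp-injective ex≈ey = ≤-antisym (exp-cancel-≤ (inj₂ ex≈ey)) (exp-cancel-≤ (inj₂ (sym ex≈ey)))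

  ln-exp : ∀ x → ln (exp x) ≈ x
  ln-exp x = exp-injective (exp-ln (0<exp x))

  ln-≤ : ∀ {x y} → 0# < x → x ≤ exp y → ln x ≤ y
  ln-≤ 0<x x≤ = exp-cancel-≤ (≤-trans (inj₂ (exp-ln 0<x)) x≤)

  ln-> : ∀ {x y} → 0# < x → exp y < x → y < ln x
  ln-> 0<x ey<x = exp-cancel-< (<-≤-trans ey<x (inj₂ (sym (exp-ln 0<x))))

  ln-mono-≤ : ∀ {x y} → 0# < x → x ≤ y → ln x ≤ ln y
  ln-mono-≤ 0<x x≤y = ln-≤ 0<x (≤-trans x≤y (inj₂ (sym (exp-ln (<-≤-trans 0<x x≤y)))))

  ln-cong : ∀ {x y} → 0# < x → x ≈ y → ln x ≈ ln y
  ln-cong 0<x x≈y =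
    ≤-antisym (ln-mono-≤ 0<x (inj₂ x≈y)) (ln-mono-≤ (<-respʳ-≈ x≈y 0<x) (inj₂ (sym x≈y)))

  ln-nonneg : ∀ {x} → 1# ≤ x → 0# ≤ ln x
  ln-nonneg 1≤x = exp-cancel-≤ (begin
    exp 0#   ≈⟨ exp-0 ⟩
    1#       ≤⟨ 1≤x ⟩
    _        ≈⟨ exp-ln (<-≤-trans 0<1 1≤x) ⟨
    exp (ln _) ∎)

  ln-pos : ∀ {x} → 1# < x → 0# < ln x
  ln-pos 1<x = ln-> (<-trans 0<1 1<x) (≤-<-trans (inj₂ exp-0) 1<x)

  ln-* : ∀ {x y} → 0# < x → 0# < y → ln (x * y) ≈ ln x + ln y
  ln-* {x} {y} 0<x 0<y = exp-injective (begin-equality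
    exp (ln (x * y))         ≈⟨ exp-ln (*-pos 0<x 0<y) ⟩
    x * y                    ≈⟨ *-cong (exp-ln 0<x) (exp-ln 0<y) ⟨
    exp (ln x) * exp (ln y)  ≈⟨ exp-+ _ _ ⟨
    exp (ln x + ln y)        ∎)

  ln≤ : ∀ {x} → 0# < x → ln x ≤ x
  ln≤ {x} 0<x = begin
    ln x         ≈⟨ +-identityˡ _ ⟨
    0# + ln x    ≤⟨ +-monoˡ-≤ _ (inj₁ 0<1) ⟩
    1# + ln x    ≤⟨ 1+x≤exp (ln x) ⟩
    exp (ln x)   ≈⟨ exp-ln 0<x ⟩
    x            ∎

  ^≈exp : ∀ {x} → 0# < x → ∀ n → x ^ n ≈ exp (fromℕ n * ln x)
  ^≈exp {x} 0<x zero    = sym (trans (exp-cong (zeroˡ _)) exp-0)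
  ^≈exp {x} 0<x (suc n) = begin-equality
    x * x ^ n                            ≈⟨ *-cong (sym (exp-ln 0<x)) (^≈exp 0<x n) ⟩
    exp (ln x) * exp (fromℕ n * ln x)    ≈⟨ exp-+ _ _ ⟨
    exp (ln x + fromℕ n * ln x)
      ≈⟨ exp-cong (solve 2 (λ l n → l :+ n :* l := (con (+ 1) :+ n) :* l) refl (ln x) (fromℕ n)) ⟩
    -- The solver's `con (+ 1)` is `fromℕ 1`, that is `1# + 0#`, and still has to be turned into
    -- `1#`.
    exp ((fromℕ 1 + fromℕ n) * ln x)     ≈⟨ exp-cong (*-congʳ (+-congʳ (+-identityʳ 1#))) ⟩
    exp (fromℕ (suc n) * ln x)           ∎

  -- Brings the threshold of the irrationality base to the form exp (- h s) that it shares with the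
  -- exponent.
  1/^≈exp : ∀ {x} → 0# < x → ∀ n → 1# / x ^ n ≈ exp (- (fromℕ n * ln x))
  1/^≈exp {x} 0<x n = *-cancelʳ-≈ 0<x^n (begin-equality
    1# / x ^ n * x ^ n                 ≈⟨ /-cancel 0<x^n ⟩
    1#                                 ≈⟨ exp-neg-inverse y ⟨
    exp (- y) * exp y                  ≈⟨ *-congˡ (^≈exp 0<x n) ⟨
    exp (- y) * x ^ n                  ∎)
    where
    y = fromℕ n * ln x
    0<x^n : 0# < x ^ n
    0<x^n = <-respʳ-≈ (sym (^≈exp 0<x n)) (0<exp y)

-- Consequences of completeness: Archimedean property, limsup, attained infima.

module Classical (em : ExcludedMiddle 0ℓ) (ℝ : RealNumbers) where
  open OrderedField ℝ
  open ExpLn ℝ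
  open Analysis em ℝ
  open Reasoning
  private module ≤± = AddExtrema _≤_

  archimedean : ∀ x → ∃[ n ] x < fromℕ n
  archimedean x with em {∃[ n ] x < fromℕ n}
  ... | yes ∃n = ∃n
  ... | no ∄n with complete (λ y → ∃[ n ] y ≡ fromℕ n) (0# , 0 , ≡.refl)
                     (x , λ { _ (n , ≡.refl) → ≮⇒≥ (λ x<n → ∄n (n , x<n)) })
  ...   | s , upper , least = contradiction (x<x+ε 0<1)
    (≤⇒≯ (≤-trans (+-monoˡ-≤ 1# s≤s-1) (inj₂ (solve 2 (λ s o → s :- o :+ o := s) refl s 1#))))
    where
    s≤s-1 : s ≤ s - 1#
    s≤s-1 = least (s - 1#) λ { _ (n , ≡.refl) → begin
      fromℕ n              ≈⟨ solve 2 (λ n o → n := o :+ n :- o) refl (fromℕ n) 1# ⟩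
      fromℕ (suc n) - 1#   ≤⟨ +-monoˡ-≤ (- 1#) (upper _ (suc n , ≡.refl)) ⟩
      s - 1#               ∎ }

  ≤±-trans′ : ∀ {x y z} → x ≤± y → y ≤± z → x ≤± z
  ≤±-trans′ = ≤±.≤±-trans ≤-trans

  Eventually : (ℕ → Set) → Set
  Eventually P = ∃[ N ] (∀ n → N ℕ.≤ n → P n)

  module _ (u : ℕ → Carrier) where
    private
      Tail : ℕ → Pred (Carrier ±) 0ℓ
      Tail n x = ∃[ k ] (n ℕ.≤ k × x ≡ [ u k ])
      Tails : Pred (Carrier ±) 0ℓ
      Tails s = ∃[ n ] s ≡ sup (Tail n)
      limsup-lower : ∀ n → limsup u ≤± sup (Tail n)
      limsup-lower n = proj₁ (proj₂ (infimum Tails)) _ (n , ≡.refl)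
      limsup-greatest : ∀ t → (∀ n → t ≤± sup (Tail n)) → t ≤± limsup u
      limsup-greatest t t≤ = proj₂ (proj₂ (infimum Tails)) t λ { _ (n , ≡.refl) → t≤ n }
      u≤sup : ∀ n k → n ℕ.≤ k → [ u k ] ≤± sup (Tail n)
      u≤sup n k n≤k = proj₁ (proj₂ (supremum (Tail n))) _ (k , n≤k , ≡.refl)

    limsup≤ : ∀ {x} → (∀ ε → 0# < ε → Eventually λ n → u n ≤ x + ε) → limsup u ≤± [ x ]
    limsup≤ {x} u≤ = close (limsup u) λ ε 0<ε → ≤±-trans′ (limsup-lower (proj₁ (u≤ ε 0<ε)))
      (proj₂ (proj₂ (supremum _)) _ λ { _ (k , N≤k , ≡.refl) → ≤±.[ proj₂ (u≤ ε 0<ε) k N≤k ] })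
      where
      close : ∀ t → (∀ ε → 0# < ε → t ≤± [ x + ε ]) → t ≤± [ x ]
      close ⊥±    _  = ≤±.⊥±≤ _
      close [ l ] l≤ = ≤±.[ ≤-by-ε (λ ε 0<ε → ≤±.[≤]-injective (l≤ ε 0<ε)) ]
      close ⊤±    ⊤≤ with ⊤≤ 1# 0<1
      ... | ()

    -- Otherwise every tail has supremum at least l + ε, since a smaller one would bound its tail;
    -- then the limsup is at least l + ε too.
    limsup-≤⇒eventually : ∀ {l} → limsup u ≤± [ l ] → ∀ ε → 0# < ε → Eventually λ n → u n ≤ l + ε
    limsup-≤⇒eventually {l} lim≤l ε 0<ε with em {Eventually λ n → u n ≤ l + ε}
    ... | yes ev = ev
    ... | no ¬ev = contradiction (x<x+ε 0<ε) (≤⇒≯ (≤±.[≤]-injective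
        (≤±-trans′ (limsup-greatest [ l + ε ] λ n → lower n (sup (Tail n)) (u≤sup n)) lim≤l)))
      where
      lower : ∀ n t → (∀ k → n ℕ.≤ k → [ u k ] ≤± t) → [ l + ε ] ≤± t
      lower n ⊥±    u≤t = contradiction (u≤t n ℕₚ.≤-refl) ≰⊥
      lower n ⊤±    u≤t = _ ≤±.≤⊤±
      lower n [ t ] u≤t with t <? l + ε
      ... | no t≮   = ≤±.[ ≮⇒≥ t≮ ]
      ... | yes t<  =
        contradiction (n , λ k n≤k → ≤-trans (≤±.[≤]-injective (u≤t k n≤k)) (inj₁ t<)) ¬ev

    -- Reduces an extended-real lower estimate for the limsup to an ε-statement about a real l ≥ 0:
    -- the value ∞ is trivial, and eventual nonnegativity of u excludes -∞ and negative values.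
    ≤limsup : ∀ t → Eventually (λ n → 0# ≤ u n) →
      (∀ l → 0# ≤ l → (∀ ε → 0# < ε → Eventually λ n → u n ≤ l + ε) → t ≤± [ l ]) → t ≤± limsup u
    ≤limsup t (N , 0≤u) t≤ = bound (limsup u) ≡.refl
      where
      0≤limsup : [ 0# ] ≤± limsup u
      0≤limsup = limsup-greatest _ λ n →
        ≤±-trans′ ≤±.[ 0≤u (N ℕ.⊔ n) (ℕₚ.m≤m⊔n N n) ] (u≤sup n (N ℕ.⊔ n) (ℕₚ.m≤n⊔m N n))
      bound : ∀ s → limsup u ≡ s → t ≤± s
      bound ⊥±    eq = contradiction (≡.subst ([ 0# ] ≤±_) eq 0≤limsup) ≰⊥
      bound ⊤±    eq = t ≤±.≤⊤±
      bound [ l ] eq = t≤ l (≤±.[≤]-injective (≡.subst ([ 0# ] ≤±_) eq 0≤limsup))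
        (limsup-≤⇒eventually (≡.subst (limsup u ≤±_) eq (≤±.≤±-reflexive-≡ ≤-reflexive-≡ ≡.refl)))
        where
        ≤-reflexive-≡ : ∀ {x y} → x ≡ y → x ≤ y
        ≤-reflexive-≡ ≡.refl = ≤-refl

  least-cases : (P : Pred Carrier 0ℓ) →
    least P ≡ Sup.⊤⁺ ⊎ ∃[ m ] (least P ≡ Sup.[ m ] × IsLeast _≤_ P m)
  least-cases P with em {∃ (IsLeast _≤_ P)}
  ... | yes (m , m-least) = inj₂ (m , ≡.refl , m-least)
  ... | no _              = inj₁ ≡.refl

  -- `least` returns the element supplied by `em`, which need not be the given one; hence the
  -- existential in the conclusion.
  IsLeast⇒least : (P : Pred Carrier 0ℓ) → ∃ (IsLeast _≤_ P) →
    ∃[ m ] (least P ≡ Sup.[ m ] × IsLeast _≤_ P m)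
  IsLeast⇒least P ∃least with em {∃ (IsLeast _≤_ P)}
  ... | yes (m , m-least) = m , ≡.refl , m-least
  ... | no ∄least         = contradiction ∃least ∄least

  -- If s is the infimum, some x in P lies below s + ε / 2, and E (x + ε / 2) passes up to E (s +
  -- ε). `C` stands for the side condition 0 < μ or 1 ≤ β, and `c` is a lower bound of P above which
  -- `C` holds and `E` is monotone.
  infimum-attained : (C E : Pred Carrier 0ℓ) →
    (let P : Pred Carrier 0ℓ ; P x = C x × (∀ ε → 0# < ε → E (x + ε))) →
    ∀ c → (∀ {x y} → c ≤ x → x ≤ y → E x → E y) → (∀ x → P x → c ≤ x) → (∀ {x} → c ≤ x → C x) → ∃ P → ∃ (IsLeast _≤_ P)
  infimum-attained C E c E-mono c≤ C-upper (x₀ , Px₀)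
    -- The infimum arises as the supremum of the lower bounds, a set containing `c` and bounded by
    -- `x₀`.
    with complete (λ y → ∀ x → C x × (∀ ε → 0# < ε → E (x + ε)) → y ≤ x) (c , c≤) (x₀ , λ y y≤ → y≤ x₀ Px₀)
  ... | s , s-upper , s-least = s , (C-upper (s-upper c c≤) , E-s) , s-lower
    where
    P : Pred Carrier 0ℓ
    P x = C x × (∀ ε → 0# < ε → E (x + ε))
    s-lower : ∀ x → P x → s ≤ x
    s-lower x Px = s-least x λ y y≤ → y≤ x Px
    E-s : ∀ ε → 0# < ε → E (s + ε)
    E-s ε 0<ε with em {∃[ x ] (P x × x < s + half ε)}
    ... | yes (x , Px@(_ , Ex) , x<) =
      E-mono (≤-trans (c≤ x Px) (inj₁ (x<x+ε (half-pos 0<ε)))) (begin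
        x + half ε               ≤⟨ +-monoˡ-≤ (half ε) (inj₁ x<) ⟩
        s + half ε + half ε      ≈⟨ +-assoc _ _ _ ⟩
        s + (half ε + half ε)    ≈⟨ +-congˡ (half+half ε) ⟩
        s + ε                    ∎) (Ex (half ε) (half-pos 0<ε))
    ... | no ∄x = contradiction (x<x+ε (half-pos 0<ε))
      (≤⇒≯ (s-upper (s + half ε) λ x Px → ≮⇒≥ λ x< → ∄x (x , Px , x<)))

-- Limits of distances, and convergents as quotients of continuants.

module Convergents (em : ExcludedMiddle 0ℓ) (ℝ : RealNumbers) where
  open OrderedField ℝ
  open ExpLn ℝ
  open Classical em ℝ
  open Analysis em ℝ
  open Continuants
  open Reasoning

  limit-∣∣≤ : ∀ {u x c r} → u ⟶ x → Eventually (λ n → ∣ u n - c ∣ ≤ r) → ∣ x - c ∣ ≤ r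
  limit-∣∣≤ {u} {x} {c} {r} u⟶x (N , ≤r) = ≤-by-ε λ ε 0<ε →
    let M , <ε = u⟶x ε 0<ε ; m = N ℕ.⊔ M in begin
    ∣ x - c ∣                   ≤⟨ dist-triangle x (u m) c ⟩
    ∣ x - u m ∣ + ∣ u m - c ∣
      ≤⟨ +-mono-≤ (≤-trans (dist-sym x (u m)) (inj₁ (<ε m (ℕₚ.m≤n⊔m N M)))) (≤r m (ℕₚ.m≤m⊔n N M)) ⟩
    ε + r                       ≈⟨ +-comm ε r ⟩
    r + ε                       ∎

  limit-∣∣≥ : ∀ {u x c r} → u ⟶ x → Eventually (λ n → r ≤ ∣ u n - c ∣) → r ≤ ∣ x - c ∣
  limit-∣∣≥ {u} {x} {c} {r} u⟶x (N , r≤) = ≤-by-ε λ ε 0<ε →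
    let M , <ε = u⟶x ε 0<ε ; m = N ℕ.⊔ M in begin
    r                           ≤⟨ r≤ m (ℕₚ.m≤m⊔n N M) ⟩
    ∣ u m - c ∣                 ≤⟨ dist-triangle (u m) x c ⟩
    ∣ u m - x ∣ + ∣ x - c ∣     ≤⟨ +-monoˡ-≤ _ (inj₁ (<ε m (ℕₚ.m≤n⊔m N M))) ⟩
    ε + ∣ x - c ∣               ≈⟨ +-comm ε _ ⟩
    ∣ x - c ∣ + ε               ∎

  -- The integer part `e 0` may have any sign, so it stays outside the continuants, which involve
  -- only the positive quotients after it.
  convergent-eq : ∀ (e : ℕ → ℤ) (d : ℕ → ℕ) → (∀ k → 1 ℕ.≤ d k) → (∀ k → e (suc k) ≡ + d k) → ∀ n →
    convergent e n * fromℕ (den d n) ≈ fromℤ (e 0) * fromℕ (den d n) + fromℕ (num d n)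
  convergent-eq e d d>0 e≡d zero    = sym (+-identityʳ _)
  convergent-eq e d d>0 e≡d (suc n) = begin-equality
    (fromℤ (e 0) + x ⁻¹) * fromℕ W
      ≈⟨ solve 3 (λ a y w → (a :+ y) :* w := a :* w :+ y :* w) refl (fromℤ (e 0)) (x ⁻¹) (fromℕ W) ⟩
    fromℤ (e 0) * fromℕ W + x ⁻¹ * fromℕ W       ≈⟨ +-congˡ (*-congˡ xD≈W) ⟨
    fromℤ (e 0) * fromℕ W + x ⁻¹ * (x * D)
      ≈⟨ +-congˡ (solve 3 (λ x y d → y :* (x :* d) := (x :* y) :* d) refl x (x ⁻¹) D) ⟩
    fromℤ (e 0) * fromℕ W + (x * x ⁻¹) * D
      ≈⟨ +-congˡ (trans (*-congʳ (*-inverse 0<x)) (*-identityˡ D)) ⟩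
    fromℤ (e 0) * fromℕ W + D                    ∎
    where
    e′ = e ∘ suc
    d′ = d ∘ suc
    x = convergent e′ n
    D = fromℕ (den d′ n)
    W = den d (suc n)
    xD≈W : x * D ≈ fromℕ W
    xD≈W = begin-equality
      x * D
        ≈⟨ convergent-eq e′ d′ (d>0 ∘ suc) (e≡d ∘ suc) n ⟩
      fromℤ (e 1) * D + fromℕ (num d′ n)
        ≡⟨ ≡.cong (λ z → fromℤ z * D + fromℕ (num d′ n)) (e≡d 0) ⟩
      fromℕ (d 0) * D + fromℕ (num d′ n)           ≈⟨ +-congʳ (fromℕ-* (d 0) (den d′ n)) ⟨
      fromℕ (d 0 ℕ.* den d′ n) + fromℕ (num d′ n)  ≈⟨ fromℕ-+ (d 0 ℕ.* den d′ n) (num d′ n) ⟨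
      fromℕ W                                      ∎
    -- `x ⁻¹` is an inverse only for nonzero x. Positivity of the tail is read off from the positive
    -- continuant `W` that equals `x * D`.
    0<x : 0# < x
    0<x = *-cancelˡ-< {D} (fromℕ-nonneg (den d′ n)) (begin-strict
      D * 0#    ≈⟨ zeroʳ D ⟩
      0#        <⟨ fromℕ-pos (den>0 d d>0 (suc n)) ⟩
      fromℕ W   ≈⟨ xD≈W ⟨
      x * D     ≈⟨ *-comm x D ⟩
      D * x     ∎)

-- Distance from α to its convergents and to arbitrary fractions.

module Approximation (em : ExcludedMiddle 0ℓ) (ℝ : RealNumbers)
  (α : RealNumbers.Carrier ℝ) (b : ℕ → ℤ)
  (α-cf : Analysis._HasContinuedFraction_ em ℝ α b) where
  open OrderedField ℝ
  open ExpLn ℝ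
  open Classical em ℝ
  open Convergents em ℝ
  open Analysis em ℝ
  open Continuants
  open Reasoning

  c : ℕ → ℕ
  c k = ℤ.∣ b (suc k) ∣

  b≡c : ∀ k → b (suc k) ≡ + c k
  b≡c k = ≡.sym (ℤₚ.0≤i⇒+∣i∣≡i (ℤₚ.<⇒≤ (proj₁ α-cf (suc k) (ℕ.s≤s ℕ.z≤n))))

  c>0 : ∀ k → 1 ℕ.≤ c k
  c>0 k = ℤₚ.drop‿+<+ (≡.subst (ℤ.0ℤ ℤ.<_) (b≡c k) (proj₁ α-cf (suc k) (ℕ.s≤s ℕ.z≤n)))

  ∏≡ : ∀ n → ∏ b n ≡ + ∏ₙ c n
  ∏≡ zero    = ≡.refl
  ∏≡ (suc n) = ≡.trans (≡.cong₂ ℤ._*_ (∏≡ n) (b≡c n)) (≡.sym (ℤₚ.pos-* (∏ₙ c n) (c n)))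

  q : ℕ → ℕ
  q = den c
  p : ℕ → ℤ
  p n = b 0 ℤ.* + q n ℤ.+ + num c n

  private
    x : ℕ → Carrier
    x = convergent b
    Q : ℕ → Carrier
    Q n = fromℕ (q n)

  0<Q : ∀ n → 0# < Q n
  0<Q n = fromℕ-pos (den>0 c c>0 n)

  xQ≈p : ∀ n → x n * Q n ≈ fromℤ (p n)
  xQ≈p n = begin-equality
    x n * Q n                                  ≈⟨ convergent-eq b c c>0 b≡c n ⟩
    fromℤ (b 0) * Q n + fromℕ (num c n)        ≈⟨ +-congʳ (fromℤ-* (b 0) (+ q n)) ⟨
    fromℤ (b 0 ℤ.* + q n) + fromℕ (num c n)    ≈⟨ fromℤ-+ (b 0 ℤ.* + q n) (+ num c n) ⟨
    fromℤ (p n)                                ∎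

  p/q≈x : ∀ n → fromℤ (p n) / Q n ≈ x n
  p/q≈x n = *-cancelʳ-≈ (0<Q n) (trans (/-cancel (0<Q n)) (sym (xQ≈p n)))

  module _ (n k : ℕ) where
    private
      m = suc n ℕ.+ k
      d = den (drop (suc n) c) k

    x-difference : ∣ x m - x n ∣ * (Q m * Q n) ≈ fromℕ d
    x-difference = begin-equality
      ∣ x m - x n ∣ * (Q m * Q n)     ≈⟨ ∣∣-* (x m - x n) (inj₁ (*-pos (0<Q m) (0<Q n))) ⟨
      ∣ (x m - x n) * (Q m * Q n) ∣   ≈⟨ ∣∣-cong cross ⟩
      ∣ N m * Q n - N n * Q m ∣       ≈⟨ [ pos , neg ]′ (determinant n k c) ⟩
      fromℕ d                         ∎
      where
      N : ℕ → Carrier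
      N n = fromℕ (num c n)
      cross : (x m - x n) * (Q m * Q n) ≈ N m * Q n - N n * Q m
      cross = begin-equality
        (x m - x n) * (Q m * Q n)
          ≈⟨ solve 4 (λ x y a b → (x :- y) :* (a :* b) := x :* a :* b :- y :* b :* a) refl (x m) (x n) (Q m) (Q n) ⟩
        x m * Q m * Q n - x n * Q n * Q m
          ≈⟨ +-cong (*-congʳ (convergent-eq b c c>0 b≡c m)) (-‿cong (*-congʳ (convergent-eq b c c>0 b≡c n))) ⟩
        (B * Q m + N m) * Q n - (B * Q n + N n) * Q m
          ≈⟨ solve 5 (λ β a b y z → (β :* a :+ y) :* b :- (β :* b :+ z) :* a := y :* b :- z :* a) refl B (Q m) (Q n) (N m) (N n) ⟩
        N m * Q n - N n * Q m ∎
        where B = fromℤ (b 0)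
      real : ∀ r s t u v → r ℕ.* s ≡ t ℕ.* u ℕ.+ v → fromℕ r * fromℕ s ≈ fromℕ t * fromℕ u + fromℕ v
      real r s t u v eq = begin-equality
        fromℕ r * fromℕ s              ≈⟨ fromℕ-* r s ⟨
        fromℕ (r ℕ.* s)                ≡⟨ ≡.cong fromℕ eq ⟩
        fromℕ (t ℕ.* u ℕ.+ v)          ≈⟨ fromℕ-+ (t ℕ.* u) v ⟩
        fromℕ (t ℕ.* u) + fromℕ v      ≈⟨ +-congʳ (fromℕ-* t u) ⟩
        fromℕ t * fromℕ u + fromℕ v    ∎
      ∣d∣ : ∣ fromℕ d ∣ ≈ fromℕ d
      ∣d∣ =
        ≤-antisym (∣∣-least ≤-refl (≤-trans (0≤x⇒-x≤0 (fromℕ-nonneg d)) (fromℕ-nonneg d))) (x≤∣x∣ _)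
      pos : num c m ℕ.* q n ≡ num c n ℕ.* q m ℕ.+ d → ∣ N m * Q n - N n * Q m ∣ ≈ fromℕ d
      pos eq = begin-equality
        ∣ N m * Q n - N n * Q m ∣
          ≈⟨ ∣∣-cong (+-congʳ (real (num c m) (q n) (num c n) (q m) d eq)) ⟩
        ∣ N n * Q m + fromℕ d - N n * Q m ∣
          ≈⟨ ∣∣-cong (solve 2 (λ a d → a :+ d :- a := d) refl (N n * Q m) (fromℕ d)) ⟩
        ∣ fromℕ d ∣                               ≈⟨ ∣d∣ ⟩
        fromℕ d                                   ∎
      neg : num c n ℕ.* q m ≡ num c m ℕ.* q n ℕ.+ d → ∣ N m * Q n - N n * Q m ∣ ≈ fromℕ d
      neg eq = begin-equality
        ∣ N m * Q n - N n * Q m ∣                 ≈⟨ ≤-antisym (dist-sym _ _) (dist-sym _ _) ⟩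
        ∣ N n * Q m - N m * Q n ∣
          ≈⟨ ∣∣-cong (+-congʳ (real (num c n) (q m) (num c m) (q n) d eq)) ⟩
        ∣ N m * Q n + fromℕ d - N m * Q n ∣
          ≈⟨ ∣∣-cong (solve 2 (λ a d → a :+ d :- a := d) refl (N m * Q n) (fromℕ d)) ⟩
        ∣ fromℕ d ∣                               ≈⟨ ∣d∣ ⟩
        fromℕ d                                   ∎

    x-difference-upper : ∣ x m - x n ∣ ≤ 1# / (Q n * Q (suc n))
    x-difference-upper = xz≤y⇒x≤y/z (*-pos (0<Q n) (0<Q (suc n))) (*-cancelˡ-≤ (0<Q m) (begin
      Q m * (w * (Q n * Q (suc n)))
        ≈⟨ solve 4 (λ a w b z → a :* (w :* (b :* z)) := z :* (w :* (a :* b))) refl (Q m) w (Q n) (Q (suc n)) ⟩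
      Q (suc n) * (w * (Q m * Q n))     ≈⟨ *-congˡ x-difference ⟩
      Q (suc n) * fromℕ d               ≈⟨ fromℕ-* (q (suc n)) d ⟨
      fromℕ (q (suc n) ℕ.* d)           ≤⟨ fromℕ-mono-≤ (den-concat-lower c c>0 n k) ⟩
      Q m                               ≈⟨ *-identityʳ _ ⟨
      Q m * 1#                          ∎))
      where w = ∣ x m - x n ∣

    x-difference-lower : 1# / (Q n * (Q (suc n) + Q n)) ≤ ∣ x m - x n ∣
    x-difference-lower =
      x≤yz⇒x/z≤y (*-pos (0<Q n) (+-pos (0<Q (suc n)) (0<Q n))) (*-cancelˡ-≤ (0<Q m) (begin
      Q m * 1#                                  ≈⟨ *-identityʳ _ ⟩
      Q m                                       ≤⟨ fromℕ-mono-≤ (den-concat-upper c c>0 n k) ⟩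
      fromℕ ((q (suc n) ℕ.+ q n) ℕ.* d)         ≈⟨ fromℕ-* (q (suc n) ℕ.+ q n) d ⟩
      fromℕ (q (suc n) ℕ.+ q n) * fromℕ d
        ≈⟨ *-cong (fromℕ-+ (q (suc n)) (q n)) (sym x-difference) ⟩
      z * (w * (Q m * Q n))
        ≈⟨ solve 4 (λ a w b z → z :* (w :* (a :* b)) := a :* (w :* (b :* z))) refl (Q m) w (Q n) z ⟩
      Q m * (w * (Q n * z))                     ∎))
      where
      w = ∣ x m - x n ∣
      z = Q (suc n) + Q n

  beyond : ∀ {P : ℕ → Set} n → (∀ k → P (suc n ℕ.+ k)) → Eventually P
  beyond {P} n Pk = suc n , λ m n<m → ≡.subst P (ℕₚ.m+[n∸m]≡n n<m) (Pk (m ℕ.∸ suc n))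

  distance-upper : ∀ n → ∣ α - x n ∣ * (Q n * Q (suc n)) ≤ 1#
  distance-upper n = x≤y/z⇒xz≤y (*-pos (0<Q n) (0<Q (suc n)))
    (limit-∣∣≤ (proj₂ α-cf) (beyond n (x-difference-upper n)))

  distance-lower : ∀ n → 1# ≤ ∣ α - x n ∣ * (Q n * (Q (suc n) + Q n))
  distance-lower n = x/z≤y⇒x≤yz (*-pos (0<Q n) (+-pos (0<Q (suc n)) (0<Q n)))
    (limit-∣∣≥ (proj₂ α-cf) (beyond n (x-difference-lower n)))

  ln-c ln-q : ℕ → Carrier
  ln-c n = ln (fromℕ (c n))
  ln-q n = ln (fromℕ (q n))

  -- Logarithmic form of |α - x n| ≤ 1 / (q n q (n + 1)) ≤ 1 / (c n (q n)²).
  convergent-height : ∀ n {h} → exp (- h) < ∣ α - fromℤ (p n) / fromℕ (q n) ∣ →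
    ln-c n + (ln-q n + ln-q n) < h
  convergent-height n {h} close = +-cancelʳ-< (- h) (exp-cancel-< (begin-strict
    exp (ln-c n + (ln-q n + ln-q n) - h)
      ≈⟨ trans (exp-+ _ _) (*-congʳ (trans (exp-+ _ _) (*-congˡ (exp-+ _ _)))) ⟩
    exp (ln-c n) * (exp (ln-q n) * exp (ln-q n)) * exp (- h)
      ≈⟨ *-congʳ (*-cong (exp-ln (fromℕ-pos (c>0 n))) (*-cong (exp-ln (0<Q n)) (exp-ln (0<Q n)))) ⟩
    C * (Q n * Q n) * exp (- h)
      <⟨ *-monoʳ-< (*-pos (fromℕ-pos (c>0 n)) (*-pos (0<Q n) (0<Q n))) close ⟩
    C * (Q n * Q n) * ∣ α - fromℤ (p n) / Q n ∣
      ≈⟨ *-congˡ (∣∣-cong (+-congˡ (-‿cong (p/q≈x n)))) ⟩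
    C * (Q n * Q n) * w
      ≈⟨ solve 3 (λ c q w → c :* (q :* q) :* w := w :* (q :* (c :* q))) refl C (Q n) w ⟩
    w * (Q n * (C * Q n))
      ≈⟨ *-congˡ (*-congˡ (fromℕ-* (c n) (q n))) ⟨
    w * (Q n * fromℕ (c n ℕ.* q n))
      ≤⟨ *-monoʳ-≤ (0≤∣x∣ _) (*-monoʳ-≤ (inj₁ (0<Q n)) (fromℕ-mono-≤ (den-lower c c>0 n))) ⟩
    w * (Q n * Q (suc n))
      ≤⟨ distance-upper n ⟩
    1#
      ≈⟨ exp-0 ⟨
    exp 0#
      ≈⟨ exp-cong (-‿inverseʳ h) ⟨
    exp (h - h) ∎))
    where
    C = fromℕ (c n)
    w = ∣ α - x n ∣

  -- Removing the integer part `b 0` turns `p n` into `num c n`, which is coprime to `q n`; so `q n`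
  -- divides s.
  same-fraction : ∀ n (r : ℤ) {s} → 1 ℕ.≤ s → r ℤ.* + q n ≡ p n ℤ.* + s → q n ℕ.≤ s
  same-fraction n r {s} 1≤s eq = ∣⇒≤ {{ℕ.>-nonZero 1≤s}}
    (coprime-divisor (coprime n c) (divides ℤ.∣ r ℤ.- b 0 ℤ.* + s ∣
      (≡.trans (≡.cong ℤ.∣_∣ (≡.trans (ℤₚ.pos-* (num c n) s) eq′)) (ℤₚ.abs-* (r ℤ.- b 0 ℤ.* + s) (+ q n)))))
    where
    eq′ : + num c n ℤ.* + s ≡ (r ℤ.- b 0 ℤ.* + s) ℤ.* + q n
    eq′ = lemma r (b 0) (+ q n) (+ s) (+ num c n) eq
      where
      lemma : ∀ r b q s N → r ℤ.* q ≡ (b ℤ.* q ℤ.+ N) ℤ.* s → N ℤ.* s ≡ (r ℤ.- b ℤ.* s) ℤ.* q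
      lemma r b q s N eq =
        ≡.trans (lhs b q s N) (≡.trans (≡.cong (ℤ._- b ℤ.* s ℤ.* q) (≡.sym eq)) (rhs r b q s))
        where
        lhs : ∀ b q s N → N ℤ.* s ≡ (b ℤ.* q ℤ.+ N) ℤ.* s ℤ.- b ℤ.* s ℤ.* q
        lhs = ℤ-Solver.solve-∀
        rhs : ∀ r b q s → r ℤ.* q ℤ.- b ℤ.* s ℤ.* q ≡ (r ℤ.- b ℤ.* s) ℤ.* q
        rhs = ℤ-Solver.solve-∀

  -- If r / s is a convergent p n / q n with n ≥ N, the distance to α is governed by c n;
  -- otherwise r / s is at distance at least 1 / (s q n) from a convergent with
  -- q n ≤ 2 s < q (n + 1), which is itself at distance at most 1 / (2 s q n) from α.
  rational-distance : ∀ N r s G → q N ℕ.≤ s → 1# ≤ G →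
    (∀ n → N ℕ.≤ n → q n ℕ.≤ s → fromℕ (c n) ≤ G) →
    1# ≤ ∣ α - fromℤ r / fromℕ s ∣ * (fromℕ (4 ℕ.* (s ℕ.* s)) * G)
  rational-distance N r s G qN≤s 1≤G c≤G =
    cases (bracket c c>0 (2 ℕ.* s) (ℕₚ.≤-trans 1≤s (ℕₚ.m≤m+n s _)))
    where
    S = fromℕ s
    y = fromℤ r / S
    w = ∣ α - y ∣
    1≤s : 1 ℕ.≤ s
    1≤s = ℕₚ.≤-trans (den>0 c c>0 N) qN≤s
    0<S : 0# < S
    0<S = fromℕ-pos 1≤s

    distinct : ∀ n → q n ℕ.≤ 2 ℕ.* s → 2 ℕ.* s ℕ.< q (suc n) → ¬ r ℤ.* + q n ≡ p n ℤ.* + s →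
      1# ≤ w * (fromℕ (4 ℕ.* (s ℕ.* s)) * G)
    distinct n qn≤2s 2s<q r≢ = begin
      1#                        ≤⟨ +-cancelʳ-≤ 1# 1+1≤ ⟩
      w * fromℕ (2 ℕ.* (s ℕ.* q n))   ≤⟨ *-monoʳ-≤ (0≤∣x∣ _) (fromℕ-mono-≤ bound) ⟩
      w * fromℕ (4 ℕ.* (s ℕ.* s))   ≈⟨ *-congˡ (*-identityʳ _) ⟨
      w * (fromℕ (4 ℕ.* (s ℕ.* s)) * 1#)
        ≤⟨ *-monoʳ-≤ (0≤∣x∣ _) (*-monoʳ-≤ (fromℕ-nonneg (4 ℕ.* (s ℕ.* s))) 1≤G) ⟩
      w * (fromℕ (4 ℕ.* (s ℕ.* s)) * G)    ∎
      where
      v = ∣ α - x n ∣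
      bound : 2 ℕ.* (s ℕ.* q n) ℕ.≤ 4 ℕ.* (s ℕ.* s)
      bound = ℕₚ.≤-trans (ℕₚ.*-monoʳ-≤ 2 (ℕₚ.*-monoʳ-≤ s qn≤2s)) (ℕₚ.≤-reflexive (lemma s))
        where
        lemma : ∀ s → 2 ℕ.* (s ℕ.* (2 ℕ.* s)) ≡ 4 ℕ.* (s ℕ.* s)
        lemma = solve-∀
      cross : (y - x n) * (S * Q n) ≈ fromℤ (r ℤ.* + q n ℤ.- p n ℤ.* + s)
      cross = begin-equality
        (y - x n) * (S * Q n)
          ≈⟨ solve 4 (λ y x s q → (y :- x) :* (s :* q) := y :* s :* q :- x :* q :* s) refl y (x n) S (Q n) ⟩
        y * S * Q n - x n * Q n * S
          ≈⟨ +-cong (*-congʳ (/-cancel 0<S)) (-‿cong (*-congʳ (xQ≈p n))) ⟩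
        fromℤ r * Q n - fromℤ (p n) * S
          ≈⟨ +-cong (fromℤ-* r (+ q n)) (trans (fromℤ-neg (p n ℤ.* + s)) (-‿cong (fromℤ-* (p n) (+ s)))) ⟨
        fromℤ (r ℤ.* + q n) + fromℤ (ℤ.- (p n ℤ.* + s))
          ≈⟨ fromℤ-+ (r ℤ.* + q n) (ℤ.- (p n ℤ.* + s)) ⟨
        fromℤ (r ℤ.* + q n ℤ.- p n ℤ.* + s)     ∎
      apart : 1# ≤ (w + v) * (S * Q n)
      apart = begin
        1#
          ≤⟨ 1≤∣fromℤ∣ _ (r≢ ∘ ℤₚ.i-j≡0⇒i≡j (r ℤ.* + q n) (p n ℤ.* + s)) ⟩
        ∣ fromℤ (r ℤ.* + q n ℤ.- p n ℤ.* + s) ∣       ≈⟨ ∣∣-cong cross ⟨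
        ∣ (y - x n) * (S * Q n) ∣                     ≈⟨ ∣∣-* _ (inj₁ (*-pos 0<S (0<Q n))) ⟩
        ∣ y - x n ∣ * (S * Q n)
          ≤⟨ *-monoˡ-≤ (inj₁ (*-pos 0<S (0<Q n))) (≤-trans (dist-triangle y α (x n)) (+-monoˡ-≤ _ (dist-sym y α))) ⟩
        (w + v) * (S * Q n)                           ∎
      near : v * (Q n * fromℕ (2 ℕ.* s)) ≤ 1#
      near =
        ≤-trans (*-monoʳ-≤ (0≤∣x∣ _) (*-monoʳ-≤ (inj₁ (0<Q n)) (fromℕ-mono-≤ (ℕₚ.<⇒≤ 2s<q)))) (distance-upper n)
      -- `apart` is doubled because `near` bounds the share of `v` in the doubled sum by 1; the
      -- other unit is left to `w`.
      1+1≤ : 1# + 1# ≤ w * fromℕ (2 ℕ.* (s ℕ.* q n)) + 1#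
      1+1≤ = begin
        1# + 1#                                                           ≤⟨ +-mono-≤ apart apart ⟩
        (w + v) * (S * Q n) + (w + v) * (S * Q n)
          ≈⟨ solve 4 (λ w v s q → (w :+ v) :* (s :* q) :+ (w :+ v) :* (s :* q) := w :* (con (+ 2) :* (s :* q)) :+ v :* (q :* (con (+ 2) :* s))) refl w v S (Q n) ⟩
        w * (fromℕ 2 * (S * Q n)) + v * (Q n * (fromℕ 2 * S))
          ≈⟨ +-cong (*-congˡ (*-congˡ (fromℕ-* s (q n)))) (*-congˡ (*-congˡ (fromℕ-* 2 s))) ⟨
        w * (fromℕ 2 * fromℕ (s ℕ.* q n)) + v * (Q n * fromℕ (2 ℕ.* s))
          ≈⟨ +-congʳ (*-congˡ (fromℕ-* 2 (s ℕ.* q n))) ⟨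
        w * fromℕ (2 ℕ.* (s ℕ.* q n)) + v * (Q n * fromℕ (2 ℕ.* s))    ≤⟨ +-monoʳ-≤ _ near ⟩
        w * fromℕ (2 ℕ.* (s ℕ.* q n)) + 1#                                ∎

    equal : ∀ n → 2 ℕ.* s ℕ.< q (suc n) → r ℤ.* + q n ≡ p n ℤ.* + s →
      1# ≤ w * (fromℕ (4 ℕ.* (s ℕ.* s)) * G)
    equal n 2s<q r≡ = begin
      1#                                              ≤⟨ distance-lower n ⟩
      ∣ α - x n ∣ * (Q n * (Q (suc n) + Q n))
        ≈⟨ *-cong (∣∣-cong (+-congˡ (-‿cong (sym y≈x)))) (*-congˡ (sym (fromℕ-+ (q (suc n)) (q n)))) ⟩
      w * (Q n * fromℕ (q (suc n) ℕ.+ q n))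
        ≈⟨ *-congˡ (fromℕ-* (q n) (q (suc n) ℕ.+ q n)) ⟨
      w * fromℕ (q n ℕ.* (q (suc n) ℕ.+ q n))
        ≤⟨ *-monoʳ-≤ (0≤∣x∣ _) (fromℕ-mono-≤ (den-product-upper c c>0 n s qn≤s)) ⟩
      w * fromℕ (4 ℕ.* (s ℕ.* s) ℕ.* c n)             ≈⟨ *-congˡ (fromℕ-* (4 ℕ.* (s ℕ.* s)) (c n)) ⟩
      w * (fromℕ (4 ℕ.* (s ℕ.* s)) * fromℕ (c n))
        ≤⟨ *-monoʳ-≤ (0≤∣x∣ _) (*-monoʳ-≤ (fromℕ-nonneg (4 ℕ.* (s ℕ.* s))) (c≤G n N≤n qn≤s)) ⟩
      w * (fromℕ (4 ℕ.* (s ℕ.* s)) * G)               ∎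
      where
      -- The bracket gives only `q n` ≤ 2 s. Equality of the fractions improves this to s, as the
      -- hypothesis on `G` demands.
      qn≤s : q n ℕ.≤ s
      qn≤s = same-fraction n r 1≤s r≡
      -- If n < N, then q (n + 1) ≤ q N ≤ s, against 2 s < q (n + 1).
      N≤n : N ℕ.≤ n
      N≤n =
        ℕₚ.≮⇒≥ λ n<N → ℕₚ.<⇒≱ 2s<q (ℕₚ.≤-trans (den-mono c c>0 n<N) (ℕₚ.≤-trans qN≤s (ℕₚ.m≤m+n s _)))
      y≈x : y ≈ x n
      y≈x = *-cancelʳ-≈ (*-pos 0<S (0<Q n)) (begin-equality
        y * (S * Q n)               ≈⟨ *-assoc y S (Q n) ⟨
        y * S * Q n                 ≈⟨ *-congʳ (/-cancel 0<S) ⟩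
        fromℤ r * Q n               ≈⟨ fromℤ-* r (+ q n) ⟨
        fromℤ (r ℤ.* + q n)         ≡⟨ ≡.cong fromℤ r≡ ⟩
        fromℤ (p n ℤ.* + s)         ≈⟨ fromℤ-* (p n) (+ s) ⟩
        fromℤ (p n) * S             ≈⟨ *-congʳ (xQ≈p n) ⟨
        x n * Q n * S
          ≈⟨ solve 3 (λ x q s → x :* q :* s := x :* (s :* q)) refl (x n) (Q n) S ⟩
        x n * (S * Q n)             ∎)

    cases : ∃[ n ] (q n ℕ.≤ 2 ℕ.* s × 2 ℕ.* s ℕ.< q (suc n)) →
      1# ≤ w * (fromℕ (4 ℕ.* (s ℕ.* s)) * G)
    cases (n , qn≤2s , 2s<q) with r ℤ.* + q n ℤₚ.≟ p n ℤ.* + s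
    ... | yes r≡ = equal n 2s<q r≡
    ... | no  r≢ = distinct n qn≤2s 2s<q r≢

  -- Logarithmic form of `rational-distance` with G = exp g: the product (2 s)² exp g is the
  -- exponential of 2 ln (2 s) + g.
  rational-height : ∀ N r s g {h} → q N ℕ.≤ s → 0# ≤ g →
    (∀ n → N ℕ.≤ n → q n ℕ.≤ s → ln-c n ≤ g) →
    let ln2s = ln 2# + ln (fromℕ s) in
    ln2s + ln2s + g < h → exp (- h) < ∣ α - fromℤ r / fromℕ s ∣
  rational-height N r s g {h} qN≤s 0≤g ln-c≤g <h = begin-strict
    exp (- h)         <⟨ exp-mono-< (neg-mono-< <h) ⟩
    exp (- k)         ≈⟨ *-identityʳ _ ⟨
    exp (- k) * 1#
      ≤⟨ *-monoʳ-≤ (inj₁ (0<exp _)) (rational-distance N r s (exp g) qN≤s (1≤exp 0≤g) c≤) ⟩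
    exp (- k) * (w * (fromℕ (4 ℕ.* (s ℕ.* s)) * exp g))   ≈⟨ *-congˡ (*-congˡ 4s²eᵍ) ⟩
    exp (- k) * (w * exp k)
      ≈⟨ solve 3 (λ a w b → a :* (w :* b) := (a :* b) :* w) refl (exp (- k)) w (exp k) ⟩
    exp (- k) * exp k * w                                 ≈⟨ *-congʳ (exp-neg-inverse k) ⟩
    1# * w                                                ≈⟨ *-identityˡ w ⟩
    w                                                     ∎
    where
    w = ∣ α - fromℤ r / fromℕ s ∣
    ln2s = ln 2# + ln (fromℕ s)
    k = ln2s + ln2s + g
    c≤ : ∀ n → N ℕ.≤ n → q n ℕ.≤ s → fromℕ (c n) ≤ exp g
    c≤ n N≤n qn≤s =
      ≤-trans (inj₂ (sym (exp-ln (fromℕ-pos (c>0 n))))) (exp-mono-≤ (ln-c≤g n N≤n qn≤s))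
    0<s = fromℕ-pos (ℕₚ.≤-trans (den>0 c c>0 N) qN≤s)
    exp-ln2s : exp ln2s ≈ 2# * fromℕ s
    exp-ln2s = trans (exp-+ _ _) (*-cong (exp-ln 0<2) (exp-ln 0<s))
    4s²eᵍ : fromℕ (4 ℕ.* (s ℕ.* s)) * exp g ≈ exp k
    4s²eᵍ = begin-equality
      fromℕ (4 ℕ.* (s ℕ.* s)) * exp g
        ≈⟨ *-congʳ (trans (fromℕ-* 4 (s ℕ.* s)) (*-congˡ (fromℕ-* s s))) ⟩
      fromℕ 4 * (fromℕ s * fromℕ s) * exp g
        ≈⟨ solve 2 (λ s e → con (+ 4) :* (s :* s) :* e := (con (+ 2) :* s) :* (con (+ 2) :* s) :* e) refl (fromℕ s) (exp g) ⟩
      (2# * fromℕ s) * (2# * fromℕ s) * exp g             ≈⟨ *-congʳ (*-cong exp-ln2s exp-ln2s) ⟨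
      exp ln2s * exp ln2s * exp g                         ≈⟨ *-congʳ (exp-+ _ _) ⟨
      exp (ln2s + ln2s) * exp g                           ≈⟨ exp-+ _ _ ⟨
      exp k                                               ∎

-- Transfer between approximation thresholds and the growth of ln b (n + 1).

module Bounds (em : ExcludedMiddle 0ℓ) (ℝ : RealNumbers)
  (α : RealNumbers.Carrier ℝ) (b : ℕ → ℤ) (α-cf : Analysis._HasContinuedFraction_ em ℝ α b) where
  open OrderedField ℝ
  open ExpLn ℝ
  open Classical em ℝ
  open Approximation em ℝ α b α-cf
  open Analysis em ℝ
  open Continuants
  open Reasoning
  private module ≤± = AddExtrema _≤_

  F*∏ F+∏ : ℕ → ℕ
  F*∏ n = F n ℕ.* ∏ₙ c n
  F+∏ n = F n ℕ.+ ∏ₙ c n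

  fromℤ-b : ∀ n → fromℤ (b (suc n)) ≡ fromℕ (c n)
  fromℤ-b n = ≡.cong fromℤ (b≡c n)

  fromℤ-F*∏ : ∀ n → fromℤ (+ F n *ℤ ∏ b n) ≡ fromℕ (F*∏ n)
  fromℤ-F*∏ n = ≡.cong fromℤ (≡.trans (≡.cong (+ F n *ℤ_) (∏≡ n)) (≡.sym (ℤₚ.pos-* (F n) (∏ₙ c n))))

  fromℤ-F+∏ : ∀ n → fromℤ (+ F n +ℤ ∏ b n) ≡ fromℕ (F+∏ n)
  fromℤ-F+∏ n = ≡.cong (λ z → fromℤ (+ F n +ℤ z)) (∏≡ n)

  q≤F*∏ : ∀ n → fromℕ (q n) ≤ fromℕ (F*∏ n)
  q≤F*∏ n = fromℕ-mono-≤ (den≤F*∏ c c>0 n)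

  -- For n < 2 the product can be 1, and its logarithm, a denominator of the exponent bound, would
  -- be 0.
  1<F*∏ : ∀ {n} → 2 ℕ.≤ n → 1# < fromℕ (F*∏ n)
  1<F*∏ {n} 2≤n = ≤-<-trans (inj₂ 1≈fromℕ1)
    (fromℕ-mono-< {1} (ℕₚ.*-mono-≤ {2} (ℕₚ.≤-trans 2≤n (n≤F n)) (∏>0 c c>0 n)))

  1<F+∏ : ∀ n → 1# < fromℕ (F+∏ n)
  1<F+∏ n = ≤-<-trans (inj₂ 1≈fromℕ1) (fromℕ-mono-< {1} (ℕₚ.+-mono-≤ (F>0 n) (∏>0 c c>0 n)))

  ln-c-nonneg : ∀ n → 0# ≤ ln-c n
  ln-c-nonneg n = ln-nonneg (1≤fromℕ (c>0 n))

  ln-q-nonneg : ∀ n → 0# ≤ ln-q n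
  ln-q-nonneg n = ln-nonneg (1≤fromℕ (den>0 c c>0 n))

  /-nonneg : ∀ {x y} → 0# ≤ x → 0# < y → 0# ≤ x / y
  /-nonneg 0≤x 0<y = *-nonneg 0≤x (inj₁ (⁻¹-pos 0<y))

  -- The inner condition of `irrationalityExponent` and `irrationalityBase`, kept definitionally
  -- equal to it so that `least P` below is the exponent or the base itself.
  Exceeds : (ℕ → Carrier) → Set
  Exceeds h = ∃[ Q ] (1 ℕ.≤ Q × (∀ (r : ℤ) (s : ℕ) → Q ℕ.≤ s → h s < ∣ α - fromℤ r / fromℕ s ∣))

  exceeds-mono : ∀ (h k : ℕ → Carrier) → (∀ s → 1 ℕ.≤ s → k s ≤ h s) → Exceeds h → Exceeds k
  exceeds-mono h k k≤h (Q , 1≤Q , h<) =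
    Q , 1≤Q , λ r s Q≤s → ≤-<-trans (k≤h s (ℕₚ.≤-trans 1≤Q Q≤s)) (h< r s Q≤s)

  -- The condition is tested on convergents only. Since n ≤ `q n`, the bound on denominators serves
  -- as a bound on indices.
  exceeds⇒ln-c : ∀ (h : ℕ → Carrier) → Exceeds (λ s → exp (- h s)) →
    Eventually λ n → ln-c n + (ln-q n + ln-q n) < h (q n)
  exceeds⇒ln-c h (Q , _ , h<) = Q , λ n Q≤n →
    convergent-height n (h< (p n) (q n) (ℕₚ.≤-trans Q≤n (≤-den c c>0 n)))

  ln-c⇒exceeds : ∀ (g : ℕ → Carrier) (h : ℕ → Carrier) N M →
    (∀ s → 1 ℕ.≤ s → 0# ≤ g s) →
    (∀ n s → N ℕ.≤ n → q n ℕ.≤ s → ln-c n ≤ g s) →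
    (∀ s → 1 ℕ.≤ s → M ℕ.≤ s → (ln 2# + ln (fromℕ s)) + (ln 2# + ln (fromℕ s)) + g s < h s) →
    Exceeds (λ s → exp (- h s))
  ln-c⇒exceeds g h N M 0≤g ln-c≤g <h =
    -- `q N` confines attention to convergents of index at least N; `M` makes `h` large enough.
    q N ℕ.⊔ M , ℕₚ.≤-trans (den>0 c c>0 N) (ℕₚ.m≤m⊔n (q N) M) , λ r s Q≤s →
    let qN≤s = ℕₚ.≤-trans (ℕₚ.m≤m⊔n (q N) M) Q≤s
        1≤s = ℕₚ.≤-trans (den>0 c c>0 N) qN≤s in
    rational-height N r s (g s) qN≤s (0≤g s 1≤s) (λ n N≤n → ln-c≤g n s N≤n)
      (<h s 1≤s (ℕₚ.≤-trans (ℕₚ.m≤n⊔m (q N) M) Q≤s))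

  -- The irrationality exponent.

  module Exponent where
    u* u+ : ℕ → Carrier
    u* n = ln (fromℤ (b (suc n))) / ln (fromℤ (+ F n *ℤ ∏ b n))
    u+ n = ln (fromℤ (b (suc n))) / ln (fromℤ (+ F n +ℤ ∏ b n))

    threshold : Carrier → ℕ → Carrier
    threshold y s = fromℕ s ^ʳ (- y)
    E : Carrier → Set
    E y = Exceeds (threshold y)
    P : Pred Carrier 0ℓ
    P μ = 0# < μ × (∀ ε → 0# < ε → E (μ + ε))

    ^ʳ-neg : ∀ s y → fromℕ s ^ʳ (- y) ≈ exp (- (y * ln (fromℕ s)))
    ^ʳ-neg s y = exp-cong (sym (RP.-‿distribˡ-* y _))

    E-mono : ∀ {x y} → x ≤ y → E x → E y
    E-mono {x} {y} x≤y = exceeds-mono (threshold x) (threshold y) λ s 1≤s →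
      exp-mono-≤ (*-monoˡ-≤ (ln-nonneg (1≤fromℕ 1≤s)) (neg-mono-≤ x≤y))

    E⇒ln-c : ∀ y → E y → Eventually λ n → ln-c n < (y - 2#) * ln-q n
    E⇒ln-c y Ey = proj₁ ev , λ n N≤n → +-cancelʳ-< (ln-q n + ln-q n) (begin-strict
      ln-c n + (ln-q n + ln-q n)                 <⟨ proj₂ ev n N≤n ⟩
      y * ln-q n
        ≈⟨ solve 2 (λ y l → y :* l := (y :- con (+ 2)) :* l :+ (l :+ l)) refl y (ln-q n) ⟩
      (y - 2#) * ln-q n + (ln-q n + ln-q n)      ∎)
      where
      ev : Eventually λ n → ln-c n + (ln-q n + ln-q n) < y * ln-q n
      ev =
        exceeds⇒ln-c (λ s → y * ln (fromℕ s)) (exceeds-mono (threshold y) (λ s → exp (- (y * ln (fromℕ s)))) (λ s _ → inj₂ (sym (^ʳ-neg s y))) Ey)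

    -- A single index with 0 ≤ ln c n < (y - 2) ln q n suffices. The sign of y - 2 is used again
    -- when `q n` is enlarged to `F*∏ n`.
    E⇒2< : ∀ y → E y → 2# < y
    E⇒2< y Ey = +-cancelʳ-< (- 2#) (begin-strict
      2# - 2#     ≈⟨ -‿inverseʳ 2# ⟩
      0#          <⟨ *-cancelˡ-< (ln-q-nonneg N) (begin-strict
        ln-q N * 0#           ≈⟨ zeroʳ _ ⟩
        0#                  ≤⟨ ln-c-nonneg N ⟩
        ln-c N                <⟨ proj₂ (E⇒ln-c y Ey) N ℕₚ.≤-refl ⟩
        (y - 2#) * ln-q N     ≈⟨ *-comm _ _ ⟩
        ln-q N * (y - 2#)     ∎) ⟩
      y - 2#      ∎)
      where N = proj₁ (E⇒ln-c y Ey)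

    -- The condition 0 < μ is not closed under infima; the lower bound 2 keeps the infimum positive.
    P⇒2≤ : ∀ μ → P μ → 2# ≤ μ
    P⇒2≤ μ (_ , Eμ) = ≤-by-ε λ ε 0<ε → inj₁ (E⇒2< (μ + ε) (Eμ ε 0<ε))

    eventually-u*≤ : ∀ m → (∀ ε → 0# < ε → E (m + ε)) → ∀ ε → 0# < ε →
      Eventually λ n → u* n ≤ m - 2# + ε
    eventually-u*≤ m Em ε 0<ε = N ℕ.⊔ 2 , bound
      where
      N = proj₁ (E⇒ln-c (m + ε) (Em ε 0<ε))
      ln-c< = proj₂ (E⇒ln-c (m + ε) (Em ε 0<ε))
      bound : ∀ n → N ℕ.⊔ 2 ℕ.≤ n → u* n ≤ m - 2# + ε
      bound n N≤n =
        ≡.subst₂ (λ x y → ln x / ln y ≤ m - 2# + ε) (≡.sym (fromℤ-b n)) (≡.sym (fromℤ-F*∏ n)) $ x≤yz⇒x/z≤y (ln-pos (1<F*∏ (ℕₚ.≤-trans (ℕₚ.m≤n⊔m N 2) N≤n))) (begin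
        ln-c n
          ≤⟨ inj₁ (ln-c< n (ℕₚ.≤-trans (ℕₚ.m≤m⊔n N 2) N≤n)) ⟩
        (m + ε - 2#) * ln-q n
          ≤⟨ *-monoʳ-≤ (inj₁ (x<y⇒0<y-x (E⇒2< (m + ε) (Em ε 0<ε))))
                                                      (ln-mono-≤ (0<Q n) (q≤F*∏ n)) ⟩
        (m + ε - 2#) * ln (fromℕ (F*∏ n))
          ≈⟨ *-congʳ (solve 3 (λ m e t → m :+ e :- t := m :- t :+ e) refl m ε 2#) ⟩
        (m - 2# + ε) * ln (fromℕ (F*∏ n))        ∎)

    lower : limsup u* ≤± (irrationalityExponent α -⁺ 2#)
    lower = [ infinite , finite ]′ (least-cases P)
      where
      infinite : least P ≡ Sup.⊤⁺ → limsup u* ≤± (least P -⁺ 2#)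
      infinite eq = ≡.subst (λ μ → limsup u* ≤± (μ -⁺ 2#)) (≡.sym eq) (limsup u* ≤±.≤⊤±)
      finite : ∃[ m ] (least P ≡ Sup.[ m ] × IsLeast _≤_ P m) → limsup u* ≤± (least P -⁺ 2#)
      finite (m , eq , (_ , Em) , _) =
        ≡.subst (λ μ → limsup u* ≤± (μ -⁺ 2#)) (≡.sym eq) (limsup≤ u* (eventually-u*≤ m Em))

    -- One half of ε is the slack in the limsup, giving ln c n ≤ (l + ε / 2) ln (2 s); the other
    -- half, times ln s, outgrows the constants coming from ln 2.
    P-limsup : ∀ l → 0# ≤ l →
      (∀ ε → 0# < ε → Eventually λ n → u+ n ≤ l + ε) → P (l + 2#)
    P-limsup l 0≤l u≤ =
      <-≤-trans 0<2 (≤-trans (≤-reflexive (sym (+-identityˡ 2#))) (+-monoˡ-≤ 2# 0≤l)) , E-l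
      where
      E-l : ∀ ε → 0# < ε → E (l + 2# + ε)
      E-l ε 0<ε =
        exceeds-mono (λ s → exp (- (y * ln (fromℕ s)))) (threshold y) (λ s _ → inj₂ (^ʳ-neg s y)) (ln-c⇒exceeds
          (λ s → e * (ln 2# + ln (fromℕ s))) (λ s → y * ln (fromℕ s)) N M
          (λ s 1≤s → *-nonneg 0≤e (+-nonneg 0≤ln2 (ln-nonneg (1≤fromℕ 1≤s)))) ln-c≤ large)
        where
        δ = half ε
        0<δ = half-pos 0<ε
        e = l + δ
        y = l + 2# + ε
        0≤e : 0# ≤ e
        0≤e = ≤-trans 0≤l (inj₁ (x<x+ε 0<δ))
        0≤ln2 : 0# ≤ ln 2#
        0≤ln2 = ln-nonneg (1≤fromℕ {2} (ℕ.s≤s ℕ.z≤n))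
        -- What remains of 2 ln (2 s) + e ln (2 s) without the multiples of ln s. `M` is chosen so
        -- that δ ln s > `C` once s ≥ `M`.
        C = ln 2# + ln 2# + e * ln 2#
        N = proj₁ (u≤ δ 0<δ)
        M = proj₁ (archimedean (exp (C / δ)))
        ln-c≤ : ∀ n s → N ℕ.≤ n → q n ℕ.≤ s → ln-c n ≤ e * (ln 2# + ln (fromℕ s))
        ln-c≤ n s N≤n qn≤s = begin
          ln-c n
            ≤⟨ x/z≤y⇒x≤yz (ln-pos (1<F+∏ n)) (≡.subst₂ (λ x y → ln x / ln y ≤ e) (fromℤ-b n) (fromℤ-F+∏ n) (proj₂ (u≤ δ 0<δ) n N≤n)) ⟩
          e * ln (fromℕ (F+∏ n))
            ≤⟨ *-monoʳ-≤ 0≤e (ln-mono-≤ (<-trans 0<1 (1<F+∏ n)) (fromℕ-mono-≤ F+∏≤2s)) ⟩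
          e * ln (fromℕ (2 ℕ.* s))
            ≈⟨ *-congˡ (trans (ln-cong (fromℕ-pos (ℕₚ.≤-trans 1≤s (ℕₚ.m≤m+n s _))) (fromℕ-* 2 s)) (ln-* 0<2 (fromℕ-pos 1≤s))) ⟩
          e * (ln 2# + ln (fromℕ s))        ∎
          where
          1≤s : 1 ℕ.≤ s
          1≤s = ℕₚ.≤-trans (den>0 c c>0 n) qn≤s
          F+∏≤2s : F+∏ n ℕ.≤ 2 ℕ.* s
          F+∏≤2s =
            ℕₚ.≤-trans (F+∏≤1+den c c>0 n) (ℕₚ.+-mono-≤ 1≤s (ℕₚ.≤-trans qn≤s (ℕₚ.≤-reflexive (≡.sym (ℕₚ.+-identityʳ s)))))
        large : ∀ s → 1 ℕ.≤ s → M ℕ.≤ s →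
          (ln 2# + ln (fromℕ s)) + (ln 2# + ln (fromℕ s)) + e * (ln 2# + ln (fromℕ s)) < y * ln (fromℕ s)
        large s 1≤s M≤s = begin-strict
          (ln 2# + L) + (ln 2# + L) + e * (ln 2# + L)
            ≈⟨ solve 4 (λ t L l d → (t :+ L) :+ (t :+ L) :+ (l :+ d) :* (t :+ L) := (t :+ t :+ (l :+ d) :* t) :+ (l :+ con (+ 2) :+ d) :* L) refl (ln 2#) L l δ ⟩
          C + (l + 2# + δ) * L          <⟨ +-monoˡ-< _ C<Lδ ⟩
          L * δ + (l + 2# + δ) * L
            ≈⟨ solve 3 (λ l d L → L :* d :+ (l :+ con (+ 2) :+ d) :* L := (l :+ con (+ 2) :+ (d :+ d)) :* L) refl l δ L ⟩
          (l + 2# + (δ + δ)) * L        ≈⟨ *-congʳ (+-congˡ (half+half ε)) ⟩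
          y * L                         ∎
          where
          L = ln (fromℕ s)
          C<Lδ : C < L * δ
          C<Lδ = begin-strict
            C            ≈⟨ /-cancel 0<δ ⟨
            C / δ * δ
              <⟨ *-monoˡ-< 0<δ (ln-> (fromℕ-pos 1≤s) (<-≤-trans (proj₂ (archimedean (exp (C / δ)))) (fromℕ-mono-≤ M≤s))) ⟩
            L * δ        ∎

    -- A real limsup l puts l + 2 into `P`. This both shows that `P` has a least element, so the
    -- exponent is finite, and bounds that element.
    upper : (irrationalityExponent α -⁺ 2#) ≤± limsup u+
    upper = ≤limsup _ _ (0 , nonneg) bound
      where
      nonneg : ∀ n → 0 ℕ.≤ n → 0# ≤ u+ n
      nonneg n _ =
        ≡.subst₂ (λ x y → 0# ≤ ln x / ln y) (≡.sym (fromℤ-b n)) (≡.sym (fromℤ-F+∏ n)) $ /-nonneg (ln-c-nonneg n) (ln-pos (1<F+∏ n))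
      bound : ∀ l → 0# ≤ l → (∀ ε → 0# < ε → Eventually λ n → u+ n ≤ l + ε) →
        (irrationalityExponent α -⁺ 2#) ≤± [ l ]
      bound l 0≤l u≤ =
        finite (IsLeast⇒least P (infimum-attained (0# <_) E 2# (λ _ → E-mono) P⇒2≤ (<-≤-trans 0<2) (l + 2# , P-limsup l 0≤l u≤)))
        where
        finite : ∃[ m ] (least P ≡ Sup.[ m ] × IsLeast _≤_ P m) → (least P -⁺ 2#) ≤± [ l ]
        finite (m , eq , _ , m≤) =
          ≡.subst (λ μ → (μ -⁺ 2#) ≤± [ l ]) (≡.sym eq) ≤±.[ +-cancelʳ-≤ 2# (begin
          m - 2# + 2#   ≈⟨ solve 2 (λ m t → m :- t :+ t := m) refl m 2# ⟩
          m             ≤⟨ m≤ _ (P-limsup l 0≤l u≤) ⟩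
          l + 2#        ∎) ]

  -- The irrationality base.

  module Base where
    u* u+ : ℕ → Carrier
    u* n = ln (fromℤ (b (suc n))) / fromℤ (+ F n *ℤ ∏ b n)
    u+ n = ln (fromℤ (b (suc n))) / fromℤ (+ F n +ℤ ∏ b n)

    threshold : Carrier → ℕ → Carrier
    threshold y s = 1# / y ^ s
    E : Carrier → Set
    E y = Exceeds (threshold y)
    P : Pred Carrier 0ℓ
    P β = 1# ≤ β × (∀ ε → 0# < ε → E (β + ε))

    E-mono : ∀ {x y} → 1# ≤ x → x ≤ y → E x → E y
    E-mono {x} {y} 1≤x x≤y = exceeds-mono (threshold x) (threshold y) λ s _ → begin
      1# / y ^ s                    ≈⟨ 1/^≈exp (<-≤-trans 0<x x≤y) s ⟩
      exp (- (fromℕ s * ln y))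
        ≤⟨ exp-mono-≤ (neg-mono-≤ (*-monoʳ-≤ (fromℕ-nonneg s) (ln-mono-≤ 0<x x≤y))) ⟩
      exp (- (fromℕ s * ln x))      ≈⟨ 1/^≈exp 0<x s ⟨
      1# / x ^ s                    ∎
      where
      0<x = <-≤-trans 0<1 1≤x

    E⇒ln-c : ∀ {y} → 0# < y → E y → Eventually λ n → ln-c n ≤ fromℕ (q n) * ln y
    E⇒ln-c {y} 0<y Ey = proj₁ ev , λ n N≤n → begin
      ln-c n                                 ≈⟨ +-identityʳ _ ⟨
      ln-c n + 0#
        ≤⟨ +-monoʳ-≤ _ (+-nonneg (ln-q-nonneg n) (ln-q-nonneg n)) ⟩
      ln-c n + (ln-q n + ln-q n)                 <⟨ proj₂ ev n N≤n ⟩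
      fromℕ (q n) * ln y                  ∎
      where
      ev : Eventually λ n → ln-c n + (ln-q n + ln-q n) < fromℕ (q n) * ln y
      ev =
        exceeds⇒ln-c (λ s → fromℕ s * ln y) (exceeds-mono (threshold y) (λ s → exp (- (fromℕ s * ln y))) (λ s _ → inj₂ (sym (1/^≈exp 0<y s))) Ey)

    eventually-u*≤ : ∀ m → 1# ≤ m → (∀ ε → 0# < ε → E (m + ε)) → ∀ ε → 0# < ε →
      Eventually λ n → u* n ≤ ln m + ε
    eventually-u*≤ m 1≤m Em ε 0<ε = N , bound
      where
      0<m = <-≤-trans 0<1 1≤m
      -- Chosen so that m + δ = m exp ε: an additive ε in ln β is a multiplicative exp ε in β.
      δ = m * exp ε - m
      0<δ : 0# < δ
      0<δ = x<y⇒0<y-x (≤-<-trans (inj₂ (sym (*-identityʳ m))) (*-monoʳ-< 0<m (1<exp 0<ε)))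
      0<m+δ = <-trans 0<m (x<x+ε 0<δ)
      ln-m+δ : ln (m + δ) ≈ ln m + ε
      ln-m+δ = begin-equality
        ln (m + δ)
          ≈⟨ ln-cong 0<m+δ (solve 2 (λ m e → m :+ (m :* e :- m) := m :* e) refl m (exp ε)) ⟩
        ln (m * exp ε)           ≈⟨ ln-* 0<m (0<exp ε) ⟩
        ln m + ln (exp ε)        ≈⟨ +-congˡ (ln-exp ε) ⟩
        ln m + ε                 ∎
      0≤ln-m+ε : 0# ≤ ln m + ε
      0≤ln-m+ε = +-nonneg (ln-nonneg 1≤m) (inj₁ 0<ε)
      N = proj₁ (E⇒ln-c 0<m+δ (Em δ 0<δ))
      ln-c≤ = proj₂ (E⇒ln-c 0<m+δ (Em δ 0<δ))
      bound : ∀ n → N ℕ.≤ n → u* n ≤ ln m + ε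
      bound n N≤n =
        ≡.subst₂ (λ x y → ln x / y ≤ ln m + ε) (≡.sym (fromℤ-b n)) (≡.sym (fromℤ-F*∏ n)) $ x≤yz⇒x/z≤y (<-≤-trans (0<Q n) (q≤F*∏ n)) (begin
        ln-c n                                     ≤⟨ ln-c≤ n N≤n ⟩
        fromℕ (q n) * ln (m + δ)                ≈⟨ *-congˡ ln-m+δ ⟩
        fromℕ (q n) * (ln m + ε)                ≤⟨ *-monoˡ-≤ 0≤ln-m+ε (q≤F*∏ n) ⟩
        fromℕ (F*∏ n) * (ln m + ε)               ≈⟨ *-comm _ _ ⟩
        (ln m + ε) * fromℕ (F*∏ n)               ∎)

    lower : limsup u* ≤± ln⁺ (irrationalityBase α)
    lower = [ infinite , finite ]′ (least-cases P)
      where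
      infinite : least P ≡ Sup.⊤⁺ → limsup u* ≤± ln⁺ (least P)
      infinite eq = ≡.subst (λ β → limsup u* ≤± ln⁺ β) (≡.sym eq) (limsup u* ≤±.≤⊤±)
      finite : ∃[ m ] (least P ≡ Sup.[ m ] × IsLeast _≤_ P m) → limsup u* ≤± ln⁺ (least P)
      finite (m , eq , (1≤m , Em) , _) =
        ≡.subst (λ β → limsup u* ≤± ln⁺ β) (≡.sym eq) (limsup≤ u* (eventually-u*≤ m 1≤m Em))

    P-limsup : ∀ l → 0# ≤ l →
      (∀ ε → 0# < ε → Eventually λ n → u+ n ≤ l + ε) → P (exp l)
    P-limsup l 0≤l u≤ = 1≤exp 0≤l , E-l
      where
      E-l : ∀ ε → 0# < ε → E (exp l + ε)
      E-l ε 0<ε =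
        exceeds-mono (λ s → exp (- (fromℕ s * ln y))) (threshold y) (λ s _ → inj₂ (1/^≈exp 0<y s)) (ln-c⇒exceeds
          (λ s → e * fromℕ (suc s)) (λ s → fromℕ s * ln y) N M
          (λ s _ → *-nonneg 0≤e (fromℕ-nonneg (suc s))) ln-c≤ large)
        where
        y = exp l + ε
        0<y : 0# < y
        0<y = <-trans (0<exp l) (x<x+ε 0<ε)
        κ = ln y - l
        0<κ : 0# < κ
        0<κ = x<y⇒0<y-x (ln-> 0<y (x<x+ε 0<ε))
        -- The gap `κ` between l and ln y is spent in quarters: one on the slack in the limsup, one
        -- on each of the two terms ln s, one on the constants.
        τ = half (half κ)
        0<τ : 0# < τ
        0<τ = half-pos (half-pos 0<κ)
        l+4τ≈ln-y : l + ((τ + τ) + (τ + τ)) ≈ ln y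
        l+4τ≈ln-y = begin-equality
          l + ((τ + τ) + (τ + τ))
            ≈⟨ +-congˡ (trans (+-cong (half+half _) (half+half _)) (half+half κ)) ⟩
          l + (ln y - l)               ≈⟨ solve 2 (λ l y → l :+ (y :- l) := y) refl l (ln y) ⟩
          ln y                         ∎
        e = l + τ
        0≤e : 0# ≤ e
        0≤e = +-nonneg 0≤l (inj₁ 0<τ)
        N = proj₁ (u≤ τ 0<τ)
        -- The - ln τ come from ln s ≤ τ s - ln τ, and the last `e` from `suc s` in place of s, the
        -- price of F n + b 1 ⋯ b n ≤ q n + 1.
        C = (ln 2# - ln τ) + (ln 2# - ln τ) + e
        M = proj₁ (archimedean (C / τ))
        ln-c≤ : ∀ n s → N ℕ.≤ n → q n ℕ.≤ s → ln-c n ≤ e * fromℕ (suc s)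
        ln-c≤ n s N≤n qn≤s = begin
          ln-c n
            ≤⟨ x/z≤y⇒x≤yz (<-trans 0<1 (1<F+∏ n)) (≡.subst₂ (λ x y → ln x / y ≤ e) (fromℤ-b n) (fromℤ-F+∏ n) (proj₂ (u≤ τ 0<τ) n N≤n)) ⟩
          e * fromℕ (F+∏ n)
            ≤⟨ *-monoʳ-≤ 0≤e (fromℕ-mono-≤ (ℕₚ.≤-trans (F+∏≤1+den c c>0 n) (ℕ.s≤s qn≤s))) ⟩
          e * fromℕ (suc s)         ∎
        large : ∀ s → 1 ℕ.≤ s → M ℕ.≤ s →
          (ln 2# + ln (fromℕ s)) + (ln 2# + ln (fromℕ s)) + e * fromℕ (suc s) < fromℕ s * ln y
        large s 1≤s M≤s = begin-strict
          (ln 2# + L) + (ln 2# + L) + e * (1# + S)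
            ≤⟨ +-monoˡ-≤ _ (+-mono-≤ (+-monoʳ-≤ _ L≤) (+-monoʳ-≤ _ L≤)) ⟩
          (ln 2# + (S * τ - ln τ)) + (ln 2# + (S * τ - ln τ)) + e * (1# + S)   ≈⟨ collect ⟩
          C + S * (l + (τ + (τ + τ)))                              <⟨ +-monoˡ-< _ C<Sτ ⟩
          S * τ + S * (l + (τ + (τ + τ)))
            ≈⟨ solve 3 (λ s l t → s :* t :+ s :* (l :+ (t :+ (t :+ t))) := s :* (l :+ ((t :+ t) :+ (t :+ t)))) refl S l τ ⟩
          S * (l + ((τ + τ) + (τ + τ)))                            ≈⟨ *-congˡ l+4τ≈ln-y ⟩
          S * ln y                                                 ∎
          where
          S = fromℕ s
          L = ln S
          0<S = fromℕ-pos 1≤s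
          -- ln (τ s) ≤ τ s absorbs ln s into an arbitrarily small multiple of s.
          L≤ : L ≤ S * τ - ln τ
          L≤ = +-cancelʳ-≤ (ln τ) (begin
            L + ln τ                   ≈⟨ ln-* 0<S 0<τ ⟨
            ln (S * τ)                 ≤⟨ ln≤ (*-pos 0<S 0<τ) ⟩
            S * τ                      ≈⟨ solve 2 (λ a b → a := a :- b :+ b) refl (S * τ) (ln τ) ⟩
            S * τ - ln τ + ln τ        ∎)
          C<Sτ : C < S * τ
          C<Sτ = begin-strict
            C            ≈⟨ /-cancel 0<τ ⟨
            C / τ * τ
              <⟨ *-monoˡ-< 0<τ (<-≤-trans (proj₂ (archimedean (C / τ))) (fromℕ-mono-≤ M≤s)) ⟩
            S * τ        ∎
          collect : (ln 2# + (S * τ - ln τ)) + (ln 2# + (S * τ - ln τ)) + e * (1# + S) ≈ C + S * (l + (τ + (τ + τ)))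
          collect = begin-equality
            (ln 2# + (S * τ - ln τ)) + (ln 2# + (S * τ - ln τ)) + e * (1# + S)
              ≈⟨ +-congˡ (trans (solve 3 (λ e o s → e :* (o :+ s) := e :* o :+ e :* s) refl e 1# S) (+-congʳ (*-identityʳ e))) ⟩
            (ln 2# + (S * τ - ln τ)) + (ln 2# + (S * τ - ln τ)) + (e + e * S)
              ≈⟨ solve 5 (λ t s τ L l → (t :+ (s :* τ :- L)) :+ (t :+ (s :* τ :- L)) :+ ((l :+ τ) :+ (l :+ τ) :* s) := ((t :- L) :+ (t :- L) :+ (l :+ τ)) :+ s :* (l :+ (τ :+ (τ :+ τ)))) refl (ln 2#) S τ (ln τ) l ⟩
            C + S * (l + (τ + (τ + τ)))   ∎

    upper : ln⁺ (irrationalityBase α) ≤± limsup u+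
    upper = ≤limsup _ _ (0 , nonneg) bound
      where
      nonneg : ∀ n → 0 ℕ.≤ n → 0# ≤ u+ n
      nonneg n _ =
        ≡.subst₂ (λ x y → 0# ≤ ln x / y) (≡.sym (fromℤ-b n)) (≡.sym (fromℤ-F+∏ n)) $ /-nonneg (ln-c-nonneg n) (<-trans 0<1 (1<F+∏ n))
      bound : ∀ l → 0# ≤ l → (∀ ε → 0# < ε → Eventually λ n → u+ n ≤ l + ε) →
        ln⁺ (irrationalityBase α) ≤± [ l ]
      bound l 0≤l u≤ =
        -- Here the side condition 1 ≤ β is closed and is itself the lower bound of `P`.
        finite (IsLeast⇒least P (infimum-attained (1# ≤_) E 1# E-mono (λ _ → proj₁) (λ 1≤ → 1≤) (exp l , P-limsup l 0≤l u≤)))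
        where
        finite : ∃[ m ] (least P ≡ Sup.[ m ] × IsLeast _≤_ P m) → ln⁺ (least P) ≤± [ l ]
        finite (m , eq , (1≤m , _) , m≤) =
          ≡.subst (λ β → ln⁺ β ≤± [ l ]) (≡.sym eq) ≤±.[ ln-≤ (<-≤-trans 0<1 1≤m) (m≤ _ (P-limsup l 0≤l u≤)) ]

corollary2 : (em : ExcludedMiddle 0ℓ) (ℝ : RealNumbers) →
    let open RealNumbers ℝ
        open Analysis em ℝ
    in
    (α : Carrier) (b : ℕ → ℤ) → Irrational α → α HasContinuedFraction b →
    (limsup (λ n → ln (fromℤ (b (suc n))) / ln (fromℤ (+ F n *ℤ ∏ b n))) ≤± (irrationalityExponent α -⁺ fromℕ 2)) ×
    ((irrationalityExponent α -⁺ fromℕ 2) ≤± limsup (λ n → ln (fromℤ (b (suc n))) / ln (fromℤ (+ F n +ℤ ∏ b n)))) ×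
    (limsup (λ n → ln (fromℤ (b (suc n))) / fromℤ (+ F n *ℤ ∏ b n)) ≤± ln⁺ (irrationalityBase α)) ×
    (ln⁺ (irrationalityBase α) ≤± limsup (λ n → ln (fromℤ (b (suc n))) / fromℤ (+ F n +ℤ ∏ b n)))
corollary2 em ℝ α b _ α-cf = Exponent.lower , Exponent.upper , Base.lower , Base.upper
  where open Bounds em ℝ α b α-cf
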